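{- For every integer $k\ge 3$ the generating function $F_{12\text{ - }3\text{ - }\cdots\text{ - }k;r}(x)$, $0\le r\le k-2$, is a rational function given by $$F_{12\text{ - }3\text{ - }\cdots\text{ - }k;r}(x)=\frac{x^{r-1}\,U_{k-2}^{\,r-1}\!\left(\frac1{2\sqrt x}\right)}{(1-x)^r\,U_k^{\,r+1}\!\left(\frac1{2\sqrt x}\right)}\qquad (1\le r\le k-2),$$ $$F_{12\text{ - }3\text{ - }\cdots\text{ - }k;0}(x)=\frac{U_{k-1}\!\left(\frac1{2\sqrt x}\right)}{\sqrt x\,U_k\!\left(\frac1{2\sqrt x}\right)},$$ where $U_j$ is the $j$th Chebyshev polynomial of the second kind.
   Context: Generalized patterns: a generalized pattern is a permutation $\tau=\tau_1\cdots\tau_k$ of $\{1,\dots,k\}$ written with dashes between some of its adjacent letters. An occurrence of $\tau$ in $\pi=\pi_1\cdots\pi_n\in S_n$ is a choice of positions $i_1<\dots<i_k$ such that $(\pi_{i_1},\dots,\pi_{i_k})$ is order-isomorphic to $(\tau_1,\dots,\tau_k)$ and $i_{j+1}=i_j+1$ whenever there is no dash between $\tau_j$ and $\tau_{j+1}$. The pattern $12\text{ - }3\text{ - }\cdots\text{ - }k$ requires only the first two letters to be adjacent in $\pi$. A permutation is $1\text{ - }3\text{ - }2$-avoiding if it has no occurrence of the classical (fully dashed) pattern $1\text{ - }3\text{ - }2$. $f_{\tau;r}(n)$ is the number of $1\text{ - }3\text{ - }2$-avoiding permutations in $S_n$ containing exactly $r$ occurrences of $\tau$ (with $S_0$ consisting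 of the empty permutation), and $F_{\tau;r}(x)=\sum_{n\ge 0} f_{\tau;r}(n)x^n$. Chebyshev polynomials of the second kind: $U_j(\cos\theta)=\sin((j+1)\theta)/\sin\theta$. The exponents on $U$ denote powers. -}

module Defs where

open import Algebra.Bundles using (CommutativeRing)
open import Algebra.Bundles.Raw using (RawRing)
import Algebra.Definitions.RawMonoid as RawMonoidDefs
import Algebra.Definitions.RawSemiring as RawSemiringDefs
open import Data.Bool.Base using (Bool; true; false)
import Data.Bool.Properties as Bool
open import Data.Fin.Base as Fin using (Fin; zero; suc; toℕ)
import Data.Fin.Properties as Fin
open import Data.Integer.Base as ℤ using ()
open import Data.List.Base as List using (List)
open import Data.Nat.Base as ℕ using (ℕ; zero; suc; _∸_)
import Data.Nat.Properties as ℕ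
open import Data.Product.Base using (_×_; ∃-syntax)
open import Data.Rational.Base as ℚ using (ℚ; 0ℚ; 1ℚ; ½)
open import Data.Vec.Base as Vec using (Vec; []; _∷_; lookup)
open import Data.Vec.Relation.Unary.AllPairs using (allPairs?)
open import Data.Vec.Relation.Unary.Unique.Propositional using (Unique)
open import Data.Vec.Relation.Unary.Unique.Propositional.Properties using (tabulate⁺)
open import Function.Base using (_∘_)
open import Relation.Binary.PropositionalEquality.Core using (_≡_)
open import Relation.Nullary.Decidable using (Dec; ¬?; _×-dec_; _→-dec_; from-yes)
open import Relation.Nullary.Negation.Core using (¬_)

------------------------------------------------------------------------
-- Permutations and generalized patterns

-- Letters and positions are numbered from 0; a permutation of n letters is
-- a word (its one-line notation) w : Vec (Fin n) n with Unique w.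

words : ∀ m n → List (Vec (Fin m) n)
words m zero    = List.[ [] ]
words m (suc n) = List.cartesianProductWith _∷_ (List.allFin m) (words m n)

unique? : ∀ {m n} (w : Vec (Fin m) n) → Dec (Unique w)
unique? = allPairs? (λ a b → ¬? (a Fin.≟ b))

-- dash a tells whether a dash separates the letter at position a from the
-- next letter; its value at the last position is never used.

record GenPattern (k : ℕ) : Set where
  field
    letters  : Vec (Fin k) k
    distinct : Unique letters
    dash     : Fin k → Bool

module _ {k n : ℕ} (τ : GenPattern k) (π : Vec (Fin n) n) (i : Vec (Fin n) k) where
  open GenPattern τ

  Increasing : Set
  Increasing = ∀ a b → a Fin.< b → lookup i a Fin.< lookup i b

  OrderIsomorphic : Set
  OrderIsomorphic = ∀ a b →
    (lookup letters a Fin.< lookup letters b →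
       lookup π (lookup i a) Fin.< lookup π (lookup i b)) ×
    (lookup π (lookup i a) Fin.< lookup π (lookup i b) →
       lookup letters a Fin.< lookup letters b)

  Adjacent : Set
  Adjacent = ∀ a b → toℕ b ≡ suc (toℕ a) → dash a ≡ false →
    toℕ (lookup i b) ≡ suc (toℕ (lookup i a))

  IsOccurrence : Set
  IsOccurrence = Increasing × OrderIsomorphic × Adjacent

  isOccurrence? : Dec IsOccurrence
  isOccurrence? = increasing? ×-dec orderIsomorphic? ×-dec adjacent?
    where
    increasing? : Dec Increasing
    increasing? = Fin.all? λ a → Fin.all? λ b →
      (a Fin.<? b) →-dec (lookup i a Fin.<? lookup i b)

    orderIsomorphic? : Dec OrderIsomorphic
    orderIsomorphic? = Fin.all? λ a → Fin.all? λ b →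
      let τ<? = lookup letters a Fin.<? lookup letters b
          π<? = lookup π (lookup i a) Fin.<? lookup π (lookup i b)
      in (τ<? →-dec π<?) ×-dec (π<? →-dec τ<?)

    adjacent? : Dec Adjacent
    adjacent? = Fin.all? λ a → Fin.all? λ b →
      (toℕ b ℕ.≟ suc (toℕ a)) →-dec ((dash a Bool.≟ false) →-dec
        (toℕ (lookup i b) ℕ.≟ suc (toℕ (lookup i a))))

occurrences : ∀ {k n} → GenPattern k → Vec (Fin n) n → ℕ
occurrences {k} {n} τ π = List.length (List.filter (isOccurrence? τ π) (words n k))

1-3-2 : GenPattern 3
1-3-2 = record
  { letters  = 1-3-2-word
  ; distinct = from-yes (unique? 1-3-2-word)
  ; dash     = λ _ → true
  }
  where
  1-3-2-word : Vec (Fin 3) 3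
  1-3-2-word = zero ∷ suc (suc zero) ∷ suc zero ∷ []

12-3-⋯-k : ∀ k → GenPattern k
12-3-⋯-k k = record
  { letters  = Vec.allFin k
  ; distinct = tabulate⁺ (λ eq → eq)
  ; dash     = λ { zero → false ; (suc _) → true }
  }

-- Number of 1-3-2-avoiding permutations of n letters with exactly r
-- occurrences of τ.

f : ∀ {k} → GenPattern k → (r n : ℕ) → ℕ
f τ r n = List.length (List.filter
  (λ π → unique? π ×-dec (occurrences 1-3-2 π ℕ.≟ 0) ×-dec (occurrences τ π ℕ.≟ r))
  (words n n))

------------------------------------------------------------------------
-- Formal power series over ℚ, as coefficient sequences

open RawMonoidDefs ℚ.+-0-rawMonoid using (sum)

Series : Set
Series = ℕ → ℚ

infix 4 _≋_
_≋_ : Series → Series → Set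
a ≋ b = ∀ n → a n ≡ b n

infixl 7 _⋆_
_⋆_ : Series → Series → Series
(a ⋆ b) n = sum {suc n} λ i → a (toℕ i) ℚ.* b (n ∸ toℕ i)

constant : ℚ → Series
constant q zero    = q
constant q (suc _) = 0ℚ

-- Multiplication by the d-th power of the variable.

shift : ℕ → Series → Series
shift zero    a n       = a n
shift (suc d) a zero    = 0ℚ
shift (suc d) a (suc n) = shift d a n

IsPolynomial : Series → Set
IsPolynomial a = ∃[ d ] ∀ n → d ℕ.< n → a n ≡ 0ℚ

IsRational : Series → Set
IsRational a = ∃[ p ] ∃[ q ]
  IsPolynomial p × IsPolynomial q × (¬ q ≋ constant 0ℚ) × (a ⋆ q ≋ p)

F : ∀ {k} → GenPattern k → ℕ → Series
F τ r n = ℤ.+ (f τ r n) ℚ./ 1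

------------------------------------------------------------------------
-- Formal Laurent series over ℚ in the variable s = √x

-- s ^- d · a stands for s⁻ᵈ · Σₙ aₙ sⁿ; different pairs may stand for the
-- same series, and _≈_ below identifies them.

infix 5 s^-_·_
record Laurent : Set where
  constructor s^-_·_
  field
    pole : ℕ
    coef : Series

laurentRawRing : RawRing _ _
laurentRawRing = record
  { Carrier = Laurent
  ; _≈_ = λ (s^- d · a) (s^- e · b) → shift e a ≋ shift d b
  ; _+_ = λ (s^- d · a) (s^- e · b) →
            s^- (d ℕ.+ e) · (λ n → shift e a n ℚ.+ shift d b n)
  ; _*_ = λ (s^- d · a) (s^- e · b) → s^- (d ℕ.+ e) · (a ⋆ b)
  ; -_  = λ (s^- d · a) → s^- d · (λ n → ℚ.- a n)
  ; 0#  = s^- 0 · constant 0ℚ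
  ; 1#  = s^- 0 · constant 1ℚ
  }

module L where
  open RawRing laurentRawRing public
  open RawSemiringDefs (RawRing.rawSemiring laurentRawRing) public using (_^_)

  infixl 6 _-_
  _-_ : Carrier → Carrier → Carrier
  a - b = a + (- b)

√x : Laurent
√x = s^- 0 · shift 1 (constant 1ℚ)

x : Laurent
x = √x L.* √x

1/2√x : Laurent
1/2√x = s^- 1 · constant ½

-- Substitution x = s² in a power series in x.

in-s² : Series → Series
in-s² a zero          = a zero
in-s² a (suc zero)    = 0ℚ
in-s² a (suc (suc n)) = in-s² (a ∘ suc) n

fromSeries : Series → Laurent
fromSeries a = s^- 0 · in-s² a

-- Laurent series form a field, so a = b / c means that c is nonzero and
-- a c = b.

infix 4 _≈_÷_
_≈_÷_ : Laurent → Laurent → Laurent → Set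
a ≈ b ÷ c = c L.≉ L.0# × a L.* c L.≈ b

------------------------------------------------------------------------
-- Chebyshev polynomials of the second kind

-- U j t is the value at t of the j-th polynomial, which has integer
-- coefficients and so can be evaluated in any ring.

module Chebyshev {c ℓ} (R : RawRing c ℓ) where
  open RawRing R

  U : ℕ → Carrier → Carrier
  U zero          t = 1#
  U (suc zero)    t = (1# + 1#) * t
  U (suc (suc j)) t = (1# + 1#) * t * U (suc j) t + (- U j t)

open Chebyshev laurentRawRing public using (U)

-- The recurrence agrees with U_j(cos θ) = sin((j+1)θ) / sin θ: below, cos n
-- and sin n stand for cos nθ and sin nθ, of which only the Pythagorean
-- identity and the addition formulas are used.

module ChebyshevTrigonometry {c ℓ} (R : CommutativeRing c ℓ) where
  open CommutativeRing R
  open Chebyshev rawRing renaming (U to Uᴿ)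
  open import Algebra.Solver.Ring.NaturalCoefficients.Default commutativeSemiring
    using (solve; con; _:+_; _:*_; _:=_)
  open import Algebra.Properties.Ring ring using (-‿distribˡ-*)
  open import Relation.Binary.Reasoning.Setoid setoid

  record IsTrigonometric (cos sin : ℕ → Carrier) : Set ℓ where
    field
      sin-0   : sin 0 ≈ 0#
      cos-0   : cos 0 ≈ 1#
      sin-suc : ∀ n → sin (suc n) ≈ sin n * cos 1 + cos n * sin 1
      cos-suc : ∀ n → cos (suc n) ≈ cos n * cos 1 - sin n * sin 1
      cos²+sin² : cos 1 * cos 1 + sin 1 * sin 1 ≈ 1#

  module _ {cos sin : ℕ → Carrier} (trig : IsTrigonometric cos sin) where
    open IsTrigonometric trig

    private
      two = 1# + 1#
      c₁  = cos 1
      s₁  = sin 1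

      cos-suc′ : ∀ n → cos (suc n) + sin n * s₁ ≈ cos n * c₁
      cos-suc′ n = begin
        cos (suc n) + sin n * s₁                       ≈⟨ +-congʳ (cos-suc n) ⟩
        cos n * c₁ + - (sin n * s₁) + sin n * s₁       ≈⟨ +-assoc _ _ _ ⟩
        cos n * c₁ + (- (sin n * s₁) + sin n * s₁)     ≈⟨ +-congˡ (-‿inverseˡ _) ⟩
        cos n * c₁ + 0#                                ≈⟨ +-identityʳ _ ⟩
        cos n * c₁                                     ∎

    sin-recurrence : ∀ n → sin (suc (suc n)) + sin n ≈ two * c₁ * sin (suc n)
    sin-recurrence n = begin
      sin (suc (suc n)) + sin n
        ≈⟨ +-cong (trans (sin-suc (suc n)) (+-congʳ (*-congʳ (sin-suc n))))
                  (sym (trans (*-congˡ cos²+sin²) (*-identityʳ (sin n)))) ⟩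
      (sin n * c₁ + cos n * s₁) * c₁ + cos (suc n) * s₁ + sin n * (c₁ * c₁ + s₁ * s₁)
        ≈⟨ solve 5 (λ S C K u v →
             (S :* u :+ C :* v) :* u :+ K :* v :+ S :* (u :* u :+ v :* v) :=
             (S :* u :+ C :* v) :* u :+ (K :+ S :* v) :* v :+ S :* u :* u)
             refl (sin n) (cos n) (cos (suc n)) c₁ s₁ ⟩
      (sin n * c₁ + cos n * s₁) * c₁ + (cos (suc n) + sin n * s₁) * s₁ + sin n * c₁ * c₁
        ≈⟨ +-congʳ (+-congˡ (*-congʳ (cos-suc′ n))) ⟩
      (sin n * c₁ + cos n * s₁) * c₁ + cos n * c₁ * s₁ + sin n * c₁ * c₁
        ≈⟨ solve 4 (λ S C u v →
             (S :* u :+ C :* v) :* u :+ C :* u :* v :+ S :* u :* u :=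
             con 2 :* u :* (S :* u :+ C :* v))
             refl (sin n) (cos n) c₁ s₁ ⟩
      two * c₁ * (sin n * c₁ + cos n * s₁)
        ≈⟨ *-congˡ (sin-suc n) ⟨
      two * c₁ * sin (suc n) ∎

    U-cos : ∀ j → Uᴿ j c₁ * s₁ ≈ sin (suc j)
    U-cos zero = *-identityˡ s₁
    U-cos (suc zero) = begin
      two * c₁ * s₁   ≈⟨ sin-recurrence 0 ⟨
      sin 2 + sin 0   ≈⟨ +-congˡ sin-0 ⟩
      sin 2 + 0#      ≈⟨ +-identityʳ _ ⟩
      sin 2           ∎
    U-cos (suc (suc j)) = begin
      (two * c₁ * Uᴿ (suc j) c₁ + - Uᴿ j c₁) * s₁
        ≈⟨ distribʳ _ _ _ ⟩
      two * c₁ * Uᴿ (suc j) c₁ * s₁ + - Uᴿ j c₁ * s₁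
        ≈⟨ +-cong (*-assoc _ _ _) (sym (-‿distribˡ-* _ _)) ⟩
      two * c₁ * (Uᴿ (suc j) c₁ * s₁) + - (Uᴿ j c₁ * s₁)
        ≈⟨ +-cong (*-congˡ (U-cos (suc j))) (-‿cong (U-cos j)) ⟩
      two * c₁ * sin (suc (suc j)) + - sin (suc j)
        ≈⟨ +-congʳ (sin-recurrence (suc j)) ⟨
      sin (suc (suc (suc j))) + sin (suc j) + - sin (suc j)
        ≈⟨ +-assoc _ _ _ ⟩
      sin (suc (suc (suc j))) + (sin (suc j) + - sin (suc j))
        ≈⟨ +-congˡ (-‿inverseʳ _) ⟩
      sin (suc (suc (suc j))) + 0#
        ≈⟨ +-identityʳ _ ⟩
      sin (suc (suc (suc j))) ∎

-- A 1-3-2-avoiding permutation is π′ n π″ with both parts 1-3-2-avoiding and every letter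
-- of π′ above every letter of π″, so it is a binary tree, and the number c_k of occurrences
-- of 12-3-⋯-k satisfies c_k(π) = c_k(π′) + c_k(π″) + c_{k-1}(π′). By induction, c_{k+1} > 0
-- forces c_k ≥ k, so for r < k nothing is lost by counting only permutations with
-- c_{k+1} = 0. Their weight q^{c_k}[c_{k+1} = 0] is multiplicative, and the generating
-- functions satisfy H_k = 1 + x H_{k-1} H_k over ℚ[[q]]. Hence H_k is a quotient of
-- convergents,
--   ((1-x) P_k - q x² P_{k-2}) H_k = (1-x) P_{k-1} - q x² P_{k-3},  P_k = x^{k/2} U_k(1/(2√x)),
-- and comparing coefficients of q, with Cassini's identity at q¹, gives the closed forms.

module Submission where

open import Defs
open import Data.Nat.Base using (ℕ; suc; _∸_; _≤_)
open import Data.Product.Base using (_×_)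

open import Algebra.Bundles using (CommutativeRing)
import Algebra.Definitions.RawMonoid as RawMonoidDefs
import Algebra.Properties.CommutativeSemiring.Exp as Exp
import Algebra.Properties.Ring as RingProperties
import Algebra.Solver.Ring.NaturalCoefficients.Default as NatSolver
open import Data.Empty using (⊥; ⊥-elim)
open import Data.Fin.Base as Fin using (Fin; zero; suc; toℕ; fromℕ<)
import Data.Fin.Properties as Fin
import Data.Integer.Base as ℤ
import Data.Integer.Properties as ℤ
open import Data.List.Base as List
  using (List; []; _∷_; _++_; length; filter; concat; tabulate; cartesianProductWith)
open import Data.List.Properties as List
  using (length-++; length-map; tabulate-cong; filter-++; filter-≐; filter-none; filter-some;
         filter-accept; filter-reject)
import Data.List.Membership.DecPropositional as DecMembership
open import Data.List.Membership.Propositional using (_∈_; _∉_; lose)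
open import Data.List.Membership.Propositional.Properties
open import Data.List.Membership.Propositional.Properties.WithK using (unique∧set⇒bag)
open import Data.List.Relation.Binary.BagAndSetEquality using (∼bag⇒↭)
open import Data.List.Relation.Binary.Permutation.Propositional.Properties using (↭-length)
open import Data.List.Relation.Unary.All as All using (All; []; _∷_)
import Data.List.Relation.Unary.All.Properties as All
open import Data.List.Relation.Unary.AllPairs as AllPairs using (AllPairs; []; _∷_)
import Data.List.Relation.Unary.AllPairs.Properties as AllPairs
open import Data.List.Relation.Unary.Any using (here; there)
open import Data.List.Relation.Unary.Unique.Propositional using (Unique)
import Data.List.Relation.Unary.Unique.Propositional.Properties as Unique
open import Data.Nat.Base as ℕ using (zero; _<_; s≤s; s≤s⁻¹; z≤n)
import Data.Nat.Properties as ℕ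
open import Data.Nat.Solver using (module +-*-Solver)
open import Data.Product.Base using (_,_; proj₁; proj₂; ∃-syntax)
open import Data.Rational.Base as ℚ using (ℚ; 0ℚ; 1ℚ; ½)
import Data.Rational.Properties as ℚ
import Data.Rational.Unnormalised.Base as ℚᵘ
import Data.Rational.Unnormalised.Properties as ℚᵘ
open import Data.Sum.Base using (_⊎_; inj₁; inj₂)
open import Data.Unit.Base using (⊤)
open import Data.Vec.Base as Vec using (Vec; []; _∷_; lookup; toList)
open import Data.Vec.Properties as Vec using (length-toList; lookup-allFin; lookup-map)
open import Data.Vec.Relation.Unary.All as VecAll using ([]; _∷_)
import Data.Vec.Relation.Unary.All.Properties as VecAll
open import Data.Vec.Relation.Unary.AllPairs as VecAllPairs using ([]; _∷_)
import Data.Vec.Relation.Unary.AllPairs.Properties as VecAllPairs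
import Data.Vec.Relation.Unary.Unique.Propositional as Vec using (Unique)
open import Function.Base using (_∘_)
open import Function.Bundles using (mk⇔)
open import Level using (0ℓ)
import Relation.Binary.Reasoning.Setoid as SetoidReasoning
open import Relation.Binary.PropositionalEquality as ≡ using (_≡_; _≢_)
open import Relation.Nullary using (¬_; Dec; yes; no)
open import Relation.Nullary.Decidable using (_×-dec_)
open import Relation.Unary using (Pred; Decidable)

-- Formal power series

-- Marking c_k by q alone does not give a closed recursion: the left part of a node would have to
-- carry c_k and c_{k-1} jointly, its own left part three statistics, and so on. The condition
-- c_{k+1} = 0 forces c_k(π′) = 0, so the same q marks only c_{k-1} on the left. The index therefore
-- drops by one at each level, and the descent ends with the decreasing words, where q marks only
-- nonemptiness. In the equation for H_k the variable q occurs linearly, with coefficients that are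
-- polynomials in x. Each coefficient of q is therefore a fixed multiple of the one before, apart
-- from the first two, which involve the right-hand side. This is why the closed form is a product
-- of powers. The arithmetic is done with the polynomials P_j over an arbitrary commutative ring and
-- used over both ℚ[[q]][[x]] and ℚ[[x]]. Square roots enter only at the end, where U_j(1/(2√x)) is
-- identified with P_j up to a power of √x.

module PowerSeries {c ℓ} (R : CommutativeRing c ℓ) where
  open CommutativeRing R
  open RawMonoidDefs +-rawMonoid using (sum)
  open NatSolver commutativeSemiring using (solve; _:+_; _:*_; _:=_; con)
  open SetoidReasoning setoid

  -- A record rather than a Π-type, so that both sides can be inferred.
  infix 4 _≐_
  record _≐_ (a b : ℕ → Carrier) : Set ℓ where
    constructor coefficientwise
    field at : ∀ n → a n ≈ b n
  open _≐_ public

  infixl 7 _⊛_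
  -- Over ℚ this is the product `_⋆_` of the statement by computation. The sum unfolds to
  -- `a 0 * b (suc n) + ((a ∘ suc) ⊛ b) n`, so inductions on the degree replace the left factor by
  -- its tail.
  _⊛_ : (ℕ → Carrier) → (ℕ → Carrier) → ℕ → Carrier
  (a ⊛ b) n = sum {suc n} λ i → a (toℕ i) * b (n ∸ toℕ i)

  infixl 6 _⊕_
  _⊕_ : (ℕ → Carrier) → (ℕ → Carrier) → ℕ → Carrier
  (a ⊕ b) n = a n + b n

  ⊝_ : (ℕ → Carrier) → ℕ → Carrier
  (⊝ a) n = - a n

  const : Carrier → ℕ → Carrier
  const u zero    = u
  const u (suc _) = 0#

  ⊛-cong : ∀ {a a′ b b′} → (∀ n → a n ≈ a′ n) → (∀ n → b n ≈ b′ n) →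
           ∀ n → (a ⊛ b) n ≈ (a′ ⊛ b′) n
  ⊛-cong p q zero    = +-congʳ (*-cong (p 0) (q 0))
  ⊛-cong p q (suc n) = +-cong (*-cong (p 0) (q (suc n))) (⊛-cong (p ∘ suc) q n)

  -- The mirror image of the unfolding by computation: here the constant term of the right factor is
  -- split off, as commutativity requires.
  ⊛-suc : ∀ a b n → (a ⊛ b) (suc n) ≈ (a ⊛ (b ∘ suc)) n + a (suc n) * b 0
  ⊛-suc a b zero =
    solve 4 (λ u v y z → u :* z :+ (v :* y :+ con 0) := u :* z :+ con 0 :+ v :* y)
      refl (a 0) (a 1) (b 0) (b 1)
  ⊛-suc a b (suc n) = trans (+-congˡ (⊛-suc (a ∘ suc) b n)) (sym (+-assoc _ _ _))

  ⊛-comm : ∀ a b n → (a ⊛ b) n ≈ (b ⊛ a) n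
  ⊛-comm a b zero    = +-congʳ (*-comm _ _)
  ⊛-comm a b (suc n) = begin
    a 0 * b (suc n) + ((a ∘ suc) ⊛ b) n  ≈⟨ +-cong (*-comm _ _) (⊛-comm (a ∘ suc) b n) ⟩
    b (suc n) * a 0 + (b ⊛ (a ∘ suc)) n  ≈⟨ +-comm _ _ ⟩
    (b ⊛ (a ∘ suc)) n + b (suc n) * a 0  ≈⟨ ⊛-suc b a n ⟨
    (b ⊛ a) (suc n)                      ∎

  ⊛-distribʳ : ∀ a b d n → ((b ⊕ d) ⊛ a) n ≈ (b ⊛ a) n + (d ⊛ a) n
  ⊛-distribʳ a b d zero =
    solve 3 (λ u v w → (v :+ w) :* u :+ con 0 := v :* u :+ con 0 :+ (w :* u :+ con 0))
      refl (a 0) (b 0) (d 0)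
  ⊛-distribʳ a b d (suc n) = trans (+-congˡ (⊛-distribʳ a (b ∘ suc) (d ∘ suc) n))
    (solve 5 (λ u v w y z → (v :+ w) :* u :+ (y :+ z) := v :* u :+ y :+ (w :* u :+ z))
      refl (a (suc n)) (b 0) (d 0) (((b ∘ suc) ⊛ a) n) (((d ∘ suc) ⊛ a) n))

  ⊛-scale : ∀ u a b n → ((λ m → u * a m) ⊛ b) n ≈ u * (a ⊛ b) n
  ⊛-scale u a b zero =
    solve 3 (λ u v w → u :* v :* w :+ con 0 := u :* (v :* w :+ con 0)) refl u (a 0) (b 0)
  ⊛-scale u a b (suc n) = trans (+-congˡ (⊛-scale u (a ∘ suc) b n))
    (solve 4 (λ u v w y → u :* v :* w :+ u :* y := u :* (v :* w :+ y))
      refl u (a 0) (b (suc n)) (((a ∘ suc) ⊛ b) n))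

  ⊛-assoc : ∀ a b d n → ((a ⊛ b) ⊛ d) n ≈ (a ⊛ (b ⊛ d)) n
  ⊛-assoc a b d zero =
    solve 3 (λ u v w → (u :* v :+ con 0) :* w :+ con 0 := u :* (v :* w :+ con 0) :+ con 0)
      refl (a 0) (b 0) (d 0)
  ⊛-assoc a b d (suc n) = begin
    (a 0 * b 0 + 0#) * d (suc n) + (((λ m → a 0 * b (suc m)) ⊕ ((a ∘ suc) ⊛ b)) ⊛ d) n
      ≈⟨ +-congˡ (⊛-distribʳ d (λ m → a 0 * b (suc m)) ((a ∘ suc) ⊛ b) n) ⟩
    (a 0 * b 0 + 0#) * d (suc n) + (((λ m → a 0 * b (suc m)) ⊛ d) n + (((a ∘ suc) ⊛ b) ⊛ d) n)
      ≈⟨ +-congˡ (+-cong (⊛-scale (a 0) (b ∘ suc) d n) (⊛-assoc (a ∘ suc) b d n)) ⟩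
    (a 0 * b 0 + 0#) * d (suc n) + (a 0 * ((b ∘ suc) ⊛ d) n + ((a ∘ suc) ⊛ (b ⊛ d)) n)
      ≈⟨ solve 5 (λ u v w y z →
           (u :* v :+ con 0) :* w :+ (u :* y :+ z) := u :* (v :* w :+ y) :+ z)
           refl (a 0) (b 0) (d (suc n)) (((b ∘ suc) ⊛ d) n) (((a ∘ suc) ⊛ (b ⊛ d)) n) ⟩
    (a ⊛ (b ⊛ d)) (suc n) ∎

  ⊛-zeroˡ : ∀ a n → ((λ _ → 0#) ⊛ a) n ≈ 0#
  ⊛-zeroˡ a zero    = trans (+-identityʳ _) (zeroˡ _)
  ⊛-zeroˡ a (suc n) = trans (+-cong (zeroˡ _) (⊛-zeroˡ a n)) (+-identityˡ 0#)

  const-⊛ : ∀ u a n → (const u ⊛ a) n ≈ u * a n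
  const-⊛ u a zero    = +-identityʳ _
  const-⊛ u a (suc n) = trans (+-congˡ (⊛-zeroˡ a n)) (+-identityʳ _)

  ⊛-identityˡ : ∀ a n → (const 1# ⊛ a) n ≈ a n
  ⊛-identityˡ a n = trans (const-⊛ 1# a n) (*-identityˡ _)

  const-0 : ∀ n → const 0# n ≈ 0#
  const-0 zero    = refl
  const-0 (suc n) = refl

  commutativeRing : CommutativeRing c ℓ
  commutativeRing = record
    { Carrier = ℕ → Carrier
    ; _≈_ = _≐_
    ; _+_ = _⊕_
    ; _*_ = _⊛_
    ; -_ = ⊝_
    ; 0# = const 0#
    ; 1# = const 1#
    ; isCommutativeRing = record
      { isRing = record
        { +-isAbelianGroup = record
          { isGroup = record
            { isMonoid = record
              { isSemigroup = record
                { isMagma = record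
                  { isEquivalence = record
                    { refl  = coefficientwise λ n → refl
                    ; sym   = λ p → coefficientwise λ n → sym (at p n)
                    ; trans = λ p q → coefficientwise λ n → trans (at p n) (at q n)
                    }
                  ; ∙-cong = λ p q → coefficientwise λ n → +-cong (at p n) (at q n)
                  }
                ; assoc = λ a b d → coefficientwise λ n → +-assoc _ _ _
                }
              ; identity =
                  (λ a → coefficientwise λ n → trans (+-congʳ (const-0 n)) (+-identityˡ _)) ,
                  (λ a → coefficientwise λ n → trans (+-congˡ (const-0 n)) (+-identityʳ _))
              }
            ; inverse =
                (λ a → coefficientwise λ n → trans (-‿inverseˡ _) (sym (const-0 n))) ,
                (λ a → coefficientwise λ n → trans (-‿inverseʳ _) (sym (const-0 n)))
            ; ⁻¹-cong = λ p → coefficientwise λ n → -‿cong (at p n)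
            }
          ; comm = λ a b → coefficientwise λ n → +-comm _ _
          }
        ; *-cong = λ p q → coefficientwise (⊛-cong (at p) (at q))
        ; *-assoc = λ a b d → coefficientwise (⊛-assoc a b d)
        ; *-identity =
            (λ a → coefficientwise (⊛-identityˡ a)) ,
            (λ a → coefficientwise λ n → trans (⊛-comm a (const 1#) n) (⊛-identityˡ a n))
        ; distrib =
            (λ a b d → coefficientwise λ n → trans (⊛-comm a (b ⊕ d) n)
               (trans (⊛-distribʳ a b d n) (+-cong (⊛-comm b a n) (⊛-comm d a n)))) ,
            (λ a b d → coefficientwise (⊛-distribʳ a b d))
        }
      ; *-comm = λ a b → coefficientwise (⊛-comm a b)
      }
    }

  X : ℕ → Carrier
  X zero          = 0#
  X (suc zero)    = 1#
  X (suc (suc _)) = 0#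

  X∘suc : ∀ n → X (suc n) ≈ const 1# n
  X∘suc zero    = refl
  X∘suc (suc n) = refl

  X-⊛-zero : ∀ a → (X ⊛ a) 0 ≈ 0#
  X-⊛-zero a = trans (+-identityʳ _) (zeroˡ _)

  X-⊛-suc : ∀ a n → (X ⊛ a) (suc n) ≈ a n
  X-⊛-suc a n = begin
    0# * a (suc n) + ((X ∘ suc) ⊛ a) n
      ≈⟨ +-cong (zeroˡ _) (⊛-cong {b = a} X∘suc (λ _ → refl) n) ⟩
    0# + (const 1# ⊛ a) n
      ≈⟨ +-identityˡ _ ⟩
    (const 1# ⊛ a) n
      ≈⟨ ⊛-identityˡ a n ⟩
    a n ∎

-- 1-3-2-avoiding permutations as binary trees

module Combinatorics where
  open import Data.Nat.Base
  open import Data.Nat.Properties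
  open import Data.Nat.Solver using (module +-*-Solver)
  open +-*-Solver using (solve; _:+_; _:=_; con)
  open DecMembership _≟_ using (_∈?_)
  open import Relation.Binary.PropositionalEquality

  data Tree : Set where
    leaf : Tree
    node : Tree → Tree → Tree

  size : Tree → ℕ
  size leaf       = 0
  size (node l r) = suc (size l + size r)

  -- The permutation of lo, …, lo + size t - 1 whose maximum sits at the root: avoiding
  -- 1-3-2 means that every letter before the maximum exceeds every letter after it.
  word : ℕ → Tree → List ℕ
  word lo leaf       = []
  word lo (node l r) = word (lo + size r) l ++ (lo + size r + size l) ∷ word lo r

  -- c j t is the number of occurrences of 12-3-⋯-(j+1) in the word of t, except that c 0
  -- only tells whether the word is nonempty: an occurrence of 12-3-⋯-k ending in the
  -- maximum is one of 12-3-⋯-(k-1) in the left part, and for k = 2 there is at most one.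
  c : ℕ → Tree → ℕ
  c zero    leaf       = 0
  c zero    (node _ _) = 1
  c (suc j) leaf       = 0
  c (suc j) (node l r) = c (suc j) l + c (suc j) r + c j l

  positive-+ : ∀ m {n} → 1 ≤ m + n → 1 ≤ m ⊎ 1 ≤ n
  positive-+ zero    p = inj₂ p
  positive-+ (suc m) p = inj₁ (s≤s z≤n)

  -- At a node, `c (2 + j)` is positive either through a subtree, which then already meets the
  -- bound, or through `c (1 + j) l`. In the latter case `c (1 + j) l` counts at least 1, and by
  -- induction the root adds `c j l ≥ 1 + j`.
  c-suc-positive : ∀ j t → 1 ≤ c (suc j) t → suc j ≤ c j t
  c-suc-positive zero    (node l r) _ = ≤-refl
  c-suc-positive (suc j) (node l r) p with positive-+ (c (2 + j) l + c (2 + j) r) p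
  ... | inj₂ q = +-mono-≤ {1} (≤-trans q (m≤m+n _ _)) (c-suc-positive j l q)
  ... | inj₁ q with positive-+ (c (2 + j) l) q
  ... | inj₁ q′ = ≤-trans (c-suc-positive (suc j) l q′) (≤-trans (m≤m+n (c (suc j) l) _) (m≤m+n _ _))
  ... | inj₂ q′ = ≤-trans (c-suc-positive (suc j) r q′) (≤-trans (m≤n+m _ (c (suc j) l)) (m≤m+n _ _))

  -- Counting occurrences of the pattern in a word

  when : ∀ {p} {P : Set p} → Dec P → ℕ → ℕ
  when (yes _) n = n
  when (no _)  n = 0

  when-+ : ∀ {p} {P : Set p} (d : Dec P) m n → when d (m + n) ≡ when d m + when d n
  when-+ (yes _) m n = refl
  when-+ (no _)  m n = refl

  when-no : ∀ {p} {P : Set p} (d : Dec P) n → ¬ P → when d n ≡ 0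
  when-no (yes p) n ¬p = ⊥-elim (¬p p)
  when-no (no _)  n ¬p = refl

  when-yes : ∀ {p} {P : Set p} (d : Dec P) n → P → when d n ≡ n
  when-yes (yes _) n p = refl
  when-yes (no ¬p) n p = ⊥-elim (¬p p)

  -- increasing j v w counts the increasing subsequences of length j of w with all
  -- letters above v; rises j w counts the occurrences of 12-3-⋯-(j+2).
  increasing : ℕ → ℕ → List ℕ → ℕ
  increasing zero    v w       = 1
  increasing (suc j) v []      = 0
  increasing (suc j) v (y ∷ w) = when (v <? y) (increasing j y w) + increasing (suc j) v w

  rises-at : ℕ → ℕ → List ℕ → ℕ
  rises-at j a []      = 0
  rises-at j a (b ∷ w) = when (a <? b) (increasing j b w)

  rises : ℕ → List ℕ → ℕ
  rises j []      = 0
  rises j (a ∷ w) = rises-at j a w + rises j w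

  increasing-below : ∀ j {v} {w} → All (_≤ v) w → increasing (suc j) v w ≡ 0
  increasing-below j {v} []            = refl
  increasing-below j {v} (_∷_ {y} p ps) =
    cong₂ _+_ (when-no (v <? y) _ (≤⇒≯ p)) (increasing-below j ps)

  -- The maximum `m` can only come last in a subsequence, and the letters of `r` never exceed the
  -- threshold. The last hypothesis keeps this so when the threshold rises to a letter of `l`.
  increasing-node : ∀ j {v m l r} → v < m → All (_≤ v) r → All (_< m) l → All (λ x → All (_≤ x) r) l →
    increasing (suc j) v (l ++ m ∷ r) ≡ increasing (suc j) v l + increasing j v l
  increasing-node j {v} {m} {[]} {r} v<m r≤v _ _ =
    trans (cong₂ _+_ (when-yes (v <? m) _ v<m) (increasing-below j r≤v)) (base j)
    where
    base : ∀ j → increasing j m r + 0 ≡ increasing j v []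
    base zero    = refl
    base (suc j) = trans (+-identityʳ _)
      (increasing-below j (All.map (λ p → ≤-trans p (<⇒≤ v<m)) r≤v))
  increasing-node zero {v} {m} {y ∷ l} v<m r≤v (_ ∷ l<m) (_ ∷ r≤l) =
    trans (cong (when (v <? y) 1 +_) (increasing-node zero v<m r≤v l<m r≤l))
      (sym (+-assoc (when (v <? y) 1) _ 1))
  increasing-node (suc j) {v} {m} {y ∷ l} v<m r≤v (y<m ∷ l<m) (r≤y ∷ r≤l) =
    trans (cong₂ _+_
      (trans (cong (when (v <? y)) (increasing-node j y<m r≤y l<m r≤l)) (when-+ (v <? y) _ _))
      (increasing-node (suc j) v<m r≤v l<m r≤l))
    (solve 4 (λ a b c d → a :+ b :+ (c :+ d) := a :+ c :+ (b :+ d)) refl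
      (when (v <? y) (increasing (suc j) y l)) (when (v <? y) (increasing j y l))
      (increasing (2 + j) v l) (increasing (suc j) v l))

  rises-max : ∀ j {m r} → All (_< m) r → rises j (m ∷ r) ≡ rises j r
  rises-max j []            = refl
  rises-max j {m} {b ∷ r} (p ∷ _) = cong (_+ rises j (b ∷ r)) (when-no (m <? b) _ (<⇒≯ p))

  nonempty : List ℕ → ℕ
  nonempty []      = 0
  nonempty (_ ∷ _) = 1

  -- With two letters adjacency binds the maximum too: it pairs only with the letter just before it,
  -- which exists when `l` is nonempty.
  rises-node-zero : ∀ {m l r} → All (_< m) l → All (_< m) r →
    rises 0 (l ++ m ∷ r) ≡ rises 0 l + rises 0 r + nonempty l
  rises-node-zero {m} {[]}        _ r<m = trans (rises-max 0 r<m) (sym (+-identityʳ _))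
  rises-node-zero {m} {a ∷ []} {r}    (p ∷ _) r<m =
    trans (cong₂ _+_ (when-yes (a <? m) _ p) (rises-max 0 r<m)) (+-comm 1 _)
  rises-node-zero {m} {a ∷ b ∷ l} {r} (_ ∷ p) r<m =
    trans (cong (when (a <? b) 1 +_) (rises-node-zero p r<m))
    (solve 3 (λ x y z → x :+ (y :+ z :+ con 1) := x :+ y :+ z :+ con 1) refl
       (when (a <? b) 1) (rises 0 (b ∷ l)) (rises 0 r))

  -- No occurrence joins a letter of `l` to one of `r`, which is not larger. An occurrence that uses
  -- `m` ends there, and since its last letter is free of the adjacency condition, deleting `m`
  -- leaves an occurrence in `l`.
  rises-node-suc : ∀ j {m l r} → All (_< m) l → All (_< m) r → All (λ x → All (_≤ x) r) l →
    rises (suc j) (l ++ m ∷ r) ≡ rises (suc j) l + rises (suc j) r + rises j l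
  rises-node-suc j {m} {[]} _ r<m _ = trans (rises-max (suc j) r<m) (sym (+-identityʳ _))
  -- The adjacent pair `a`, `m` is a rise, but nothing in `r` can continue it.
  rises-node-suc j {m} {a ∷ []} {r} (p ∷ _) r<m _ =
    trans (cong₂ _+_
      (trans (when-yes (a <? m) _ p) (increasing-below j (All.map <⇒≤ r<m)))
      (rises-max (suc j) r<m))
      (sym (+-identityʳ _))
  rises-node-suc j {m} {a ∷ b ∷ l} {r} (_ ∷ b<m ∷ l<m) r<m (_ ∷ r≤b ∷ r≤l) =
    trans (cong₂ _+_
      (trans (cong (when (a <? b)) (increasing-node j b<m r≤b l<m r≤l)) (when-+ (a <? b) _ _))
      (rises-node-suc j (b<m ∷ l<m) r<m (r≤b ∷ r≤l)))
    (solve 5 (λ u v x y z → u :+ v :+ (x :+ y :+ z) := u :+ x :+ y :+ (v :+ z)) refl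
      (when (a <? b) (increasing (suc j) b l)) (when (a <? b) (increasing j b l))
      (rises (suc j) (b ∷ l)) (rises (suc j) r) (rises j (b ∷ l)))

  length-word : ∀ lo t → length (word lo t) ≡ size t
  length-word lo leaf       = refl
  length-word lo (node l r) = trans (length-++ (word (lo + size r) l))
    (trans (cong₂ (λ a b → a + suc b) (length-word _ l) (length-word _ r)) (+-suc _ _))

  Between : ℕ → ℕ → ℕ → Set
  Between lo hi x = lo ≤ x × x < hi

  word-between : ∀ lo t → All (Between lo (lo + size t)) (word lo t)
  word-between lo leaf       = []
  word-between lo (node l r) = All.++⁺
    (All.map (λ (p , q) → ≤-trans (m≤m+n _ _) p , <-trans q top) (word-between (lo + size r) l))
    ((≤-trans (m≤m+n _ (size r)) (m≤m+n _ _) , top) ∷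
     All.map (λ (p , q) → p , <-trans (<-≤-trans q (m≤m+n _ _)) top) (word-between lo r))
    where
    top : lo + size r + size l < lo + suc (size l + size r)
    top = ≤-reflexive (solve 3 (λ a b c → con 1 :+ (a :+ b :+ c) := a :+ (con 1 :+ (c :+ b)))
      refl lo (size r) (size l))

  word-left< : ∀ lo l r → All (_< lo + size r + size l) (word (lo + size r) l)
  word-left< lo l r = All.map proj₂ (word-between (lo + size r) l)

  word-right< : ∀ lo l r → All (_< lo + size r + size l) (word lo r)
  word-right< lo l r = All.map (λ (_ , q) → <-≤-trans q (m≤m+n _ _)) (word-between lo r)

  word-right<left : ∀ lo l r → All (λ x → All (_< x) (word lo r)) (word (lo + size r) l)
  word-right<left lo l r =
    All.map (λ (p , _) → All.map (λ (_ , q) → <-≤-trans q p) (word-between lo r))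
      (word-between (lo + size r) l)

  nonempty-word : ∀ lo t → nonempty (word lo t) ≡ c 0 t
  nonempty-word lo leaf       = refl
  nonempty-word lo (node l r) with word (lo + size r) l
  ... | []    = refl
  ... | _ ∷ _ = refl

  rises-word : ∀ j lo t → rises j (word lo t) ≡ c (suc j) t
  rises-word j lo leaf = refl
  rises-word zero lo (node l r) =
    trans (rises-node-zero (word-left< lo l r) (word-right< lo l r))
    (cong₂ _+_ (cong₂ _+_ (rises-word 0 _ l) (rises-word 0 _ r)) (nonempty-word _ l))
  rises-word (suc j) lo (node l r) =
    trans (rises-node-suc j (word-left< lo l r) (word-right< lo l r)
       (All.map (All.map <⇒≤) (word-right<left lo l r)))
    (cong₂ _+_ (cong₂ _+_ (rises-word (suc j) _ l) (rises-word (suc j) _ r)) (rises-word j _ l))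

  -- Avoiding words are the words of trees

  Avoids : List ℕ → Set
  Avoids []      = ⊤
  Avoids (a ∷ w) = AllPairs (λ b c → ¬ (a < c × c < b)) w × Avoids w

  AllPairs-++⁻ : ∀ {a ℓ} {A : Set a} {R : A → A → Set ℓ} xs {ys} → AllPairs R (xs ++ ys) →
    AllPairs R xs × AllPairs R ys × All (λ x → All (R x) ys) xs
  AllPairs-++⁻ []       ps       = [] , ps , []
  AllPairs-++⁻ (x ∷ xs) (p ∷ ps) =
    let qs , rs , ss = AllPairs-++⁻ xs ps ; p₁ , p₂ = All.++⁻ xs p
    in p₁ ∷ qs , rs , p₂ ∷ ss

  Avoids-++⁺ : ∀ {m l r} → Avoids l → Avoids r → All (_< m) l → All (_< m) r →
    All (λ x → All (_< x) r) l → Avoids (l ++ m ∷ r)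
  Avoids-++⁺ {m} {[]} {r} _ q _ r<m _ = go r<m , q
    where
    go : ∀ {w} → All (_< m) w → AllPairs (λ b c → ¬ (m < c × c < b)) w
    go []       = []
    go (_ ∷ ps) = All.map (λ p (p′ , _) → <⇒≯ p p′) ps ∷ go ps
  Avoids-++⁺ {m} {a ∷ l} {r} (p , ps) q (_ ∷ l<m) r<m (r<a ∷ r<l) =
    AllPairs.++⁺ p (All.map (λ s (s′ , _) → <⇒≯ s s′) r<a ∷ go r<a)
      (All.map (λ s → (λ (_ , s′) → <⇒≯ s s′) ∷ All.map (λ z (z′ , _) → <⇒≯ z z′) r<a) l<m) ,
    Avoids-++⁺ ps q l<m r<m r<l
    where
    go : ∀ {w} → All (_< a) w → AllPairs (λ b c → ¬ (a < c × c < b)) w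
    go []       = []
    go (_ ∷ ps) = All.map (λ p (p′ , _) → <⇒≯ p p′) ps ∷ go ps

  -- A letter of `l` below a letter of `r` would form a 1-3-2 with `m` in the middle.
  Avoids-++⁻ : ∀ {m} l {r} → Avoids (l ++ m ∷ r) → All (_< m) r →
    Avoids l × Avoids r × All (λ x → All (_≤ x) r) l
  Avoids-++⁻ [] (_ , q) _ = _ , q , []
  Avoids-++⁻ (a ∷ l) (p , ps) r<m =
    let ql , qr , r≤l = Avoids-++⁻ l ps r<m
        pl , pr , _ = AllPairs-++⁻ l p
    in (pl , ql) , qr ,
       All.zipWith (λ (s , s′) → ≮⇒≥ (λ a<x → s (a<x , s′))) (AllPairs.head pr , r<m) ∷ r≤l

  Avoids-word : ∀ lo t → Avoids (word lo t)
  Avoids-word lo leaf       = _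
  Avoids-word lo (node l r) = Avoids-++⁺ (Avoids-word _ l) (Avoids-word _ r)
    (word-left< lo l r) (word-right< lo l r) (word-right<left lo l r)

  Unique-word : ∀ lo t → Unique (word lo t)
  Unique-word lo leaf       = []
  Unique-word lo (node l r) = AllPairs.++⁺ (Unique-word _ l)
    (All.map >⇒≢ (word-right< lo l r) ∷ Unique-word _ r)
    (All.zipWith (λ (p , q) → <⇒≢ p ∷ All.map >⇒≢ q) (word-left< lo l r , word-right<left lo l r))

  lookup-injective : ∀ {a} {A : Set a} {w : List A} → Unique w →
    ∀ i j → List.lookup w i ≡ List.lookup w j → i ≡ j
  lookup-injective (p ∷ u) zero    zero    eq = refl
  lookup-injective (p ∷ u) zero    (suc j) eq = ⊥-elim (All.lookup p (∈-lookup j) eq)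
  lookup-injective (p ∷ u) (suc i) zero    eq = ⊥-elim (All.lookup p (∈-lookup i) (sym eq))
  lookup-injective (p ∷ u) (suc i) (suc j) eq = cong suc (lookup-injective u i j eq)

  -- Pigeonhole: the distances of the letters from `lo` inject the positions of `w` into
  -- `Fin (hi ∸ lo)`.
  unique-between : ∀ {lo hi w} → Unique w → All (Between lo hi) w → length w ≤ hi ∸ lo
  unique-between {lo} {hi} {w} u b =
    Fin.injective⇒≤ {f = λ i → fromℕ< (bound i)} λ {i} {j} eq →
      lookup-injective u i j (∸-cancelʳ-≡ (proj₁ (bᵢ i)) (proj₁ (bᵢ j))
        (Fin.fromℕ<-injective _ _ (bound i) (bound j) eq))
    where
    bᵢ : ∀ i → Between lo hi (List.lookup w i)
    bᵢ i = All.lookup b (∈-lookup i)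
    bound : ∀ i → List.lookup w i ∸ lo < hi ∸ lo
    bound i = ∸-monoˡ-< (proj₂ (bᵢ i)) (proj₁ (bᵢ i))

  -- If the top value were missing, `suc m` distinct letters would share `m` values.
  max-∈ : ∀ lo m w → length w ≡ suc m → Unique w → All (Between lo (lo + suc m)) w → lo + m ∈ w
  max-∈ lo m w len u b with (lo + m) ∈? w
  ... | yes p = p
  ... | no ¬p = ⊥-elim (<-irrefl (sym (m+n∸m≡n lo m)) (subst (_≤ lo + m ∸ lo) len
    (unique-between u (All.tabulate λ {x} x∈ → let p , q = All.lookup b x∈ in
      p , ≤∧≢⇒< (s≤s⁻¹ (subst (x <_) (+-suc lo m) q)) λ { refl → ¬p x∈ }))))

  -- Counting shows that each part fills an interval. Below a letter `y` of `l` lie all letters of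
  -- `r`, so `y` is at least `lo + length r`. Between a letter `x` of `r` and the maximum lie all
  -- letters of `l`, so `x` is below `lo + length r`.
  word-surjective-node : ∀ lo l r → let m = lo + (length l + length r) in
    Unique (l ++ m ∷ r) → All (Between lo (suc m)) (l ++ m ∷ r) → Avoids (l ++ m ∷ r) →
    All (Between (lo + length r) (lo + length r + length l)) l × All (Between lo (lo + length r)) r ×
    Unique l × Unique r × Avoids l × Avoids r
  word-surjective-node lo l r u b a =
    All.tabulate (λ {y} y∈ →
      ≤-trans (+-monoʳ-≤ lo (unique-between ur (All.zip (lo≤r , All.lookup r<l y∈))))
        (≤-reflexive (m+[n∸m]≡n (proj₁ (All.lookup bl y∈)))) ,
      subst (y <_) (solve 3 (λ x y z → x :+ (y :+ z) := x :+ z :+ y) refl lo (length l) (length r))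
        (All.lookup l<m y∈)) ,
    All.tabulate (λ {x} x∈ → All.lookup lo≤r x∈ ,
      +-cancelʳ-≤ (length l) (suc x) (lo + length r)
        (≤-trans (+-monoʳ-≤ (suc x) (unique-between {suc x} {m} ul
            (All.tabulate λ y∈ → All.lookup (All.lookup r<l y∈) x∈ , All.lookup l<m y∈)))
          (≤-reflexive (trans (m+[n∸m]≡n (All.lookup r<m x∈))
            (solve 3 (λ x y z → x :+ (y :+ z) := x :+ z :+ y) refl lo (length l) (length r)))))) ,
    ul , ur , al , ar
    where
    m = lo + (length l + length r)
    ul   = proj₁ (AllPairs-++⁻ l u)
    mr   = proj₁ (proj₂ (AllPairs-++⁻ l u))
    ur   = AllPairs.tail mr
    l≢mr = proj₂ (proj₂ (AllPairs-++⁻ l u))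
    bl   = proj₁ (All.++⁻ l b)
    br   = All.tail (proj₂ (All.++⁻ l b))
    l<m : All (_< m) l
    l<m = All.zipWith (λ ((_ , p) , q) → ≤∧≢⇒< (s≤s⁻¹ p) (All.head q)) (bl , l≢mr)
    r<m : All (_< m) r
    r<m = All.zipWith (λ ((_ , p) , q) → ≤∧≢⇒< (s≤s⁻¹ p) (q ∘ sym)) (br , AllPairs.head mr)
    avoids = Avoids-++⁻ l a r<m
    al  = proj₁ avoids
    ar  = proj₁ (proj₂ avoids)
    lo≤r : All (lo ≤_) r
    lo≤r = All.map proj₁ br
    r<l : All (λ x → All (_< x) r) l
    r<l = All.zipWith (λ (p , q) → All.zipWith (λ (p , q) → ≤∧≢⇒< p (q ∘ sym)) (p , All.tail q))
      (proj₂ (proj₂ avoids) , l≢mr)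

  -- The bound `n` carries the recursion: the parts on either side of the maximum are shorter than
  -- `w`, but the left one is not a subterm of it.
  word-surjective : ∀ n lo w → length w ≤ n → Unique w → All (Between lo (lo + length w)) w → Avoids w →
    ∃[ t ] word lo t ≡ w
  word-surjective n       lo []        _ _ _ _ = leaf , refl
  word-surjective (suc n) lo w@(_ ∷ w′) (s≤s len) u b a
    with l , r , eq ← ∈-∃++ (max-∈ lo (length w′) w refl u b)
    = let lens = suc-injective (trans (sym (+-suc (length l) (length r)))
                   (trans (sym (length-++ l)) (cong length (sym eq))))
      in go l r lens (trans eq (cong (λ k → l ++ (lo + k) ∷ r) (sym lens)))
    where
    go : ∀ l r → length l + length r ≡ length w′ → w ≡ l ++ (lo + (length l + length r)) ∷ r →
      ∃[ t ] word lo t ≡ w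
    go l r lens eq
      with bl , br , ul , ur , al , ar ← word-surjective-node lo l r
             (subst Unique eq u)
             (subst₂ (λ k → All (Between lo k))
               (trans (+-suc lo _) (cong (λ k → suc (lo + k)) (sym lens))) eq b)
             (subst Avoids eq a)
      with tl , refl ← word-surjective n (lo + length r) l
             (≤-trans (≤-trans (m≤m+n _ _) (≤-reflexive lens)) len) ul bl al
         | tr , refl ← word-surjective n lo r
             (≤-trans (≤-trans (m≤n+m _ (length l)) (≤-reflexive lens)) len) ur br ar
      = node tl tr , trans
          (cong₂ (λ i j → word (lo + i) tl ++ (lo + i + j) ∷ word lo tr)
            (sym (length-word lo tr)) (sym (length-word _ tl)))
          (sym (trans eq (cong (λ k → l ++ k ∷ r)
            (solve 3 (λ x y z → x :+ (y :+ z) := x :+ z :+ y) refl lo (length l) (length r)))))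

  ++-∷-injective : ∀ {m : ℕ} {l l′ r r′} → m ∉ l → m ∉ l′ → l ++ m ∷ r ≡ l′ ++ m ∷ r′ → l ≡ l′ × r ≡ r′
  ++-∷-injective {l = []}    {[]}     _ _ refl = refl , refl
  ++-∷-injective {l = []}    {_ ∷ _}  _ q eq = ⊥-elim (q (here (List.∷-injectiveˡ eq)))
  ++-∷-injective {l = _ ∷ _} {[]}     p _ eq = ⊥-elim (p (here (sym (List.∷-injectiveˡ eq))))
  ++-∷-injective {l = x ∷ l} {y ∷ l′} p q eq
    with refl , eq′ ← List.∷-injective eq
    with refl , refl ← ++-∷-injective {l = l} {l′} (p ∘ there) (q ∘ there) eq′ = refl , refl

  size≡length : ∀ {lo lo′ t t′} → word lo t ≡ word lo′ t′ → size t ≡ size t′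
  size≡length {lo} {lo′} {t} {t′} eq =
    trans (sym (length-word lo t)) (trans (cong length eq) (length-word lo′ t′))

  max-∉-left : ∀ lo l r → lo + size r + size l ∉ word (lo + size r) l
  max-∉-left lo l r m∈ = <-irrefl refl (All.lookup (word-left< lo l r) m∈)

  -- Equal words have equal lengths, hence the same maximum, and this occurs only once in each. The
  -- right parts are compared first, because `r ≡ r′` makes both left words start at the same
  -- offset.
  word-injective : ∀ lo t t′ → word lo t ≡ word lo t′ → t ≡ t′
  word-injective lo leaf leaf _ = refl
  word-injective lo leaf t′@(node _ _) eq with () ← size≡length {lo} {lo} {leaf} {t′} eq
  word-injective lo t@(node _ _) leaf eq with () ← size≡length {lo} {lo} {t} {leaf} eq
  word-injective lo t@(node l r) t′@(node l′ r′) eq = go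
    (trans (flip l r) (trans (cong (lo +_) (suc-injective (size≡length {lo} {lo} {t} {t′} eq)))
      (sym (flip l′ r′))))
    where
    flip : ∀ l r → lo + size r + size l ≡ lo + (size l + size r)
    flip l r = solve 3 (λ x y z → x :+ z :+ y := x :+ (y :+ z)) refl lo (size l) (size r)
    go : lo + size r + size l ≡ lo + size r′ + size l′ → t ≡ t′
    go maxima
      with p , q ← ++-∷-injective (max-∉-left lo l r)
                     (subst (_∉ word (lo + size r′) l′) (sym maxima) (max-∉-left lo l′ r′))
                     (trans eq (cong (λ m → word (lo + size r′) l′ ++ m ∷ word lo r′) (sym maxima)))
      with refl ← word-injective lo r r′ q
      with refl ← word-injective _ l l′ p = refl

  -- Enumeration of trees by size

  nodes : (ℕ → List Tree) → ∀ n → Fin (suc n) → List Tree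
  nodes T n i = cartesianProductWith node (T (toℕ i)) (T (n ∸ toℕ i))

  -- The fuel f only has to be at least n.
  treesWithin : ℕ → ℕ → List Tree
  treesWithin f       zero    = leaf ∷ []
  treesWithin zero    (suc n) = []
  treesWithin (suc f) (suc n) = concat (tabulate (nodes (treesWithin f) n))

  trees : ℕ → List Tree
  trees n = treesWithin n n

  toℕ≤ : ∀ {n} (i : Fin (suc n)) → toℕ i ≤ n
  toℕ≤ i = s≤s⁻¹ (Fin.toℕ<n i)

  treesWithin-fuel : ∀ f g n → n ≤ f → n ≤ g → treesWithin f n ≡ treesWithin g n
  treesWithin-fuel f g zero _ _ = refl
  treesWithin-fuel (suc f) (suc g) (suc n) (s≤s p) (s≤s q) = cong concat (tabulate-cong λ i →
    cong₂ (cartesianProductWith node)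
      (treesWithin-fuel f g _ (≤-trans (toℕ≤ i) p) (≤-trans (toℕ≤ i) q))
      (treesWithin-fuel f g _ (≤-trans (m∸n≤m n (toℕ i)) p) (≤-trans (m∸n≤m n (toℕ i)) q)))

  trees-suc : ∀ n → trees (suc n) ≡ concat (tabulate (nodes trees n))
  trees-suc n = cong concat (tabulate-cong λ i → cong₂ (cartesianProductWith node)
    (treesWithin-fuel n _ _ (toℕ≤ i) ≤-refl) (treesWithin-fuel n _ _ (m∸n≤m n (toℕ i)) ≤-refl))

  ∈-treesWithin⁻ : ∀ f n {t} → t ∈ treesWithin f n → size t ≡ n
  ∈-treesWithin⁻ f zero (here refl) = refl
  ∈-treesWithin⁻ (suc f) (suc n) {t} t∈
    with ts , t∈ts , ts∈ ← ∈-concat⁻′ (tabulate (nodes (treesWithin f) n)) t∈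
    with i , eq ← ∈-tabulate⁻ {f = nodes (treesWithin f) n} ts∈
    with l , r , l∈ , r∈ , refl ← ∈-cartesianProductWith⁻ node
      (treesWithin f (toℕ i)) (treesWithin f (n ∸ toℕ i)) (subst (t ∈_) eq t∈ts)
    = cong suc (trans
        (cong₂ _+_ (∈-treesWithin⁻ f (toℕ i) l∈) (∈-treesWithin⁻ f (n ∸ toℕ i) r∈))
        (m+[n∸m]≡n (toℕ≤ i)))

  ∈-treesWithin⁺ : ∀ f t → size t ≤ f → t ∈ treesWithin f (size t)
  ∈-treesWithin⁺ f leaf _ = here refl
  ∈-treesWithin⁺ (suc f) (node l r) (s≤s p) =
    ∈-concat⁺′
      (∈-cartesianProductWith⁺ node
        (subst (λ i → l ∈ treesWithin f i) (sym i≡) (∈-treesWithin⁺ f l (≤-trans (m≤m+n _ _) p)))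
        (subst (λ i → r ∈ treesWithin f i)
          (sym (trans (cong (size l + size r ∸_) i≡) (m+n∸m≡n (size l) (size r))))
          (∈-treesWithin⁺ f r (≤-trans (m≤n+m _ (size l)) p))))
      (∈-tabulate⁺ {f = nodes (treesWithin f) (size l + size r)} i)
    where
    i = fromℕ< (s≤s (m≤m+n (size l) (size r)))
    i≡ : toℕ i ≡ size l
    i≡ = Fin.toℕ-fromℕ< (s≤s (m≤m+n (size l) (size r)))

  -- The blocks are disjoint because the size of the left subtree recovers the index of the block.
  treesWithin-unique : ∀ f n → Unique (treesWithin f n)
  treesWithin-unique f       zero    = [] ∷ []
  treesWithin-unique zero    (suc n) = []
  treesWithin-unique (suc f) (suc n) = Unique.concat⁺
    (All.tabulate⁺ λ i → Unique.cartesianProductWith⁺ node (λ { refl → refl , refl })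
      (treesWithin-unique f (toℕ i)) (treesWithin-unique f (n ∸ toℕ i)))
    (AllPairs.tabulate⁺ λ {i} {j} i≢j {t} (p , q) → i≢j (disjoint i j p q))
    where
    disjoint : ∀ (i j : Fin (suc n)) {t} →
      t ∈ nodes (treesWithin f) n i → t ∈ nodes (treesWithin f) n j → i ≡ j
    disjoint i j p q
      with l , _ , l∈ , _ , refl ← ∈-cartesianProductWith⁻ node (treesWithin f (toℕ i)) _ p
      with _ , _ , l∈′ , _ , refl ← ∈-cartesianProductWith⁻ node (treesWithin f (toℕ j)) _ q
      = Fin.toℕ-injective (trans (sym (∈-treesWithin⁻ f (toℕ i) l∈)) (∈-treesWithin⁻ f (toℕ j) l∈′))

  -- Occurrences as counts of position words

  count : ∀ {A : Set} {P : Pred A 0ℓ} → Decidable P → List A → ℕ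
  count P? xs = length (filter P? xs)

  module _ {A : Set} {P : Pred A 0ℓ} (P? : Decidable P) where

    count-++ : ∀ xs ys → count P? (xs ++ ys) ≡ count P? xs + count P? ys
    count-++ xs ys = trans (cong length (filter-++ P? xs ys)) (length-++ (filter P? xs))

    count-map : ∀ {B : Set} (g : B → A) xs → count P? (List.map g xs) ≡ count (P? ∘ g) xs
    count-map g []       = refl
    count-map g (x ∷ xs) with P? (g x)
    ... | yes _ = cong suc (count-map g xs)
    ... | no  _ = count-map g xs

    count-none : ∀ xs → (∀ x → ¬ P x) → count P? xs ≡ 0
    count-none xs ¬P = cong length (filter-none P? (All.universal ¬P xs))

    count-cong : ∀ {Q : Pred A 0ℓ} (Q? : Decidable Q) xs → (∀ x → P x → Q x) → (∀ x → Q x → P x) →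
      count P? xs ≡ count Q? xs
    count-cong Q? xs to from = cong length (filter-≐ P? Q? ((λ {x} → to x) , λ {x} → from x) xs)

  count-when : ∀ {A D : Set} {P Q : Pred A 0ℓ} (P? : Decidable P) (D? : Dec D) (Q? : Decidable Q) xs →
    (∀ x → P x → D × Q x) → (∀ x → D → Q x → P x) → count P? xs ≡ when D? (count Q? xs)
  count-when P? (yes d) Q? xs to from = count-cong P? Q? xs (λ x p → proj₂ (to x p)) (λ x → from x d)
  count-when P? (no ¬d) Q? xs to from = count-none P? xs (λ x p → ¬d (proj₁ (to x p)))

  module _ {m j : ℕ} {P : Pred (Vec (Fin m) (suc j)) 0ℓ} (P? : Decidable P) where

    count-∷ : ∀ q qs ws → count P? (cartesianProductWith _∷_ (q ∷ qs) ws) ≡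
      count (P? ∘ (q ∷_)) ws + count P? (cartesianProductWith _∷_ qs ws)
    count-∷ q qs ws = trans (count-++ P? (List.map (q ∷_) ws) _) (cong (_+ _) (count-map P? (q ∷_) ws))

  words-suc : ∀ n j → words (suc n) (suc j) ≡
    cartesianProductWith _∷_ (zero ∷ List.map suc (List.allFin n)) (words (suc n) j)
  words-suc n j = cong (λ qs → cartesianProductWith _∷_ (zero ∷ qs) (words (suc n) j))
    (sym (List.map-tabulate (λ i → i) suc))

  Nonzero : ∀ {n} → Fin (suc n) → Set
  Nonzero q = q ≢ zero

  -- Position words that avoid 0 are the shifts of position words for the permutation without its
  -- first letter. This turns the count over all position words into a recursion along the word.
  count-words-nonzero : ∀ n j {P : Pred (Vec (Fin (suc n)) j) 0ℓ} (P? : Decidable P) →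
    (∀ i → P i → VecAll.All Nonzero i) →
    count P? (words (suc n) j) ≡ count (P? ∘ Vec.map suc) (words n j)

  count-map-suc : ∀ n j {P : Pred (Vec (Fin (suc n)) (suc j)) 0ℓ} (P? : Decidable P) →
    (∀ q i → P (suc q ∷ i) → VecAll.All Nonzero i) → ∀ qs →
    count P? (cartesianProductWith _∷_ (List.map suc qs) (words (suc n) j)) ≡
    count (P? ∘ Vec.map suc) (cartesianProductWith _∷_ qs (words n j))
  count-map-suc n j P? nz []       = refl
  count-map-suc n j P? nz (q ∷ qs) = begin
    count P? (cartesianProductWith _∷_ (suc q ∷ List.map suc qs) (words (suc n) j))
      ≡⟨ count-∷ P? (suc q) (List.map suc qs) (words (suc n) j) ⟩
    count (P? ∘ (suc q ∷_)) (words (suc n) j) +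
    count P? (cartesianProductWith _∷_ (List.map suc qs) (words (suc n) j))
      ≡⟨ cong₂ _+_ (count-words-nonzero n j (P? ∘ (suc q ∷_)) (nz q)) (count-map-suc n j P? nz qs) ⟩
    count (P? ∘ Vec.map suc ∘ (q ∷_)) (words n j) +
    count (P? ∘ Vec.map suc) (cartesianProductWith _∷_ qs (words n j))
      ≡⟨ count-∷ (P? ∘ Vec.map suc) q qs (words n j) ⟨
    count (P? ∘ Vec.map suc) (cartesianProductWith _∷_ (q ∷ qs) (words n j)) ∎
    where open ≡-Reasoning

  count-words-nonzero n zero P? nz with P? []
  ... | yes _ = refl
  ... | no  _ = refl
  count-words-nonzero n (suc j) P? nz = begin
    count P? (words (suc n) (suc j))
      ≡⟨ cong (count P?) (words-suc n j) ⟩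
    count P? (cartesianProductWith _∷_ (zero ∷ List.map suc (List.allFin n)) (words (suc n) j))
      ≡⟨ count-∷ P? zero (List.map suc (List.allFin n)) (words (suc n) j) ⟩
    count (P? ∘ (zero ∷_)) (words (suc n) j) +
    count P? (cartesianProductWith _∷_ (List.map suc (List.allFin n)) (words (suc n) j))
      ≡⟨ cong₂ _+_ (count-none (P? ∘ (zero ∷_)) (words (suc n) j) λ i p → VecAll.head (nz _ p) refl)
           (count-map-suc n j P? (λ q i p → VecAll.tail (nz _ p)) (List.allFin n)) ⟩
    count (P? ∘ Vec.map suc) (words n (suc j)) ∎
    where open ≡-Reasoning

  -- Only the first of several increasing positions can be 0. The two summands, first position 0 or
  -- not, are those in the recursions of `increasing` and `rises`.
  count-words-suc : ∀ n j {P : Pred (Vec (Fin (suc n)) (suc j)) 0ℓ} (P? : Decidable P) →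
    (∀ q i → P (q ∷ i) → VecAll.All Nonzero i) →
    count P? (words (suc n) (suc j)) ≡
    count (P? ∘ (zero ∷_) ∘ Vec.map suc) (words n j) + count (P? ∘ Vec.map suc) (words n (suc j))
  count-words-suc n j P? nz =
    trans (cong (count P?) (words-suc n j))
    (trans (count-∷ P? zero (List.map suc (List.allFin n)) (words (suc n) j))
    (cong₂ _+_ (count-words-nonzero n j (P? ∘ (zero ∷_)) (nz zero))
       (count-map-suc n j P? (λ q → nz (suc q)) (List.allFin n))))

  module _ {n : ℕ} (v : Vec ℕ n) where

    Rise : Fin n → Fin n → Set
    Rise p q = p Fin.< q × lookup v p < lookup v q

    Rising : ∀ {j} → Pred (Vec (Fin n) j) 0ℓ
    Rising = VecAllPairs.AllPairs Rise

    rising? : ∀ {j} → Decidable (Rising {j})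
    rising? = VecAllPairs.allPairs? λ p q → (p Fin.<? q) ×-dec (lookup v p <? lookup v q)

    RisingAbove : ∀ {j} → ℕ → Pred (Vec (Fin n) j) 0ℓ
    RisingAbove lo i = VecAll.All (λ q → lo < lookup v q) i × Rising i

    risingAbove? : ∀ {j} lo → Decidable (RisingAbove {j} lo)
    risingAbove? lo i = VecAll.all? (λ q → lo <? lookup v q) i ×-dec rising? i

    RisingFrom : ∀ {j} → Pred (Vec (Fin n) (2 + j)) 0ℓ
    RisingFrom i@(p ∷ q ∷ _) = toℕ q ≡ suc (toℕ p) × Rising i

    risingFrom? : ∀ {j} → Decidable (RisingFrom {j})
    risingFrom? i@(p ∷ q ∷ _) = (toℕ q ≟ suc (toℕ p)) ×-dec rising? i

  module _ {n y : ℕ} {v : Vec ℕ n} where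

    Rising-nonzero : ∀ {j q} {i : Vec (Fin (suc n)) j} → Rising (y ∷ v) (q ∷ i) → VecAll.All Nonzero i
    Rising-nonzero (p ∷ _) = VecAll.map (λ { (() , _) refl }) p

    Rising-suc⁺ : ∀ {j} {i : Vec (Fin n) j} → Rising v i → Rising (y ∷ v) (Vec.map suc i)
    Rising-suc⁺ ps = VecAllPairs.map⁺ (VecAllPairs.map (λ (p , q) → s<s p , q) ps)

    Rising-suc⁻ : ∀ {j} {i : Vec (Fin n) j} → Rising (y ∷ v) (Vec.map suc i) → Rising v i
    Rising-suc⁻ {i = []}    []       = []
    Rising-suc⁻ {i = _ ∷ _} (p ∷ ps) = VecAll.map (λ (p , q) → s<s⁻¹ p , q) (VecAll.map⁻ p) ∷
      Rising-suc⁻ ps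

    Rising-zero⁺ : ∀ {j} {i : Vec (Fin n) j} → RisingAbove v y i → Rising (y ∷ v) (zero ∷ Vec.map suc i)
    Rising-zero⁺ (p , ps) = VecAll.map⁺ (VecAll.map (z<s ,_) p) ∷ Rising-suc⁺ ps

    Rising-zero⁻ : ∀ {j} {i : Vec (Fin n) j} → Rising (y ∷ v) (zero ∷ Vec.map suc i) → RisingAbove v y i
    Rising-zero⁻ (p ∷ ps) = VecAll.map proj₂ (VecAll.map⁻ p) , Rising-suc⁻ ps

  count-risingAbove : ∀ {n} j (v : Vec ℕ n) lo →
    count (risingAbove? v lo) (words n j) ≡ increasing j lo (toList v)
  count-risingAbove zero    v       lo with risingAbove? v lo []
  ... | yes _ = refl
  ... | no ¬p = ⊥-elim (¬p ([] , []))
  count-risingAbove (suc j) []      lo = refl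
  count-risingAbove {suc n} (suc j) (y ∷ v) lo = trans
    (count-words-suc n j (risingAbove? (y ∷ v) lo) (λ q i (_ , p) → Rising-nonzero p))
    (cong₂ _+_
      (trans
        (count-when (risingAbove? (y ∷ v) lo ∘ (zero ∷_) ∘ Vec.map suc) (lo <? y)
          (risingAbove? v y) (words n j)
          (λ i → λ { (p ∷ _ , q) → p , Rising-zero⁻ q })
          (λ i p q → p ∷ VecAll.map⁺ (VecAll.map (<-trans p) (proj₁ q)) , Rising-zero⁺ q))
        (cong (when (lo <? y)) (count-risingAbove j v y)))
      (trans
        (count-cong (risingAbove? (y ∷ v) lo ∘ Vec.map suc) (risingAbove? v lo) (words n (suc j))
          (λ i (p , q) → VecAll.map⁻ p , Rising-suc⁻ q) (λ i (p , q) → VecAll.map⁺ p , Rising-suc⁺ q))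
        (count-risingAbove (suc j) v lo)))

  count-risingFrom : ∀ {n} j (v : Vec ℕ n) →
    count (risingFrom? v) (words n (2 + j)) ≡ rises j (toList v)
  count-risingFrom j []      = refl
  count-risingFrom {suc n} j (y ∷ v) = trans
    (count-words-suc n (suc j) (risingFrom? (y ∷ v)) (λ { q (_ ∷ _) (_ , p) → Rising-nonzero p }))
    (cong₂ _+_ (first v)
      (trans
        (count-cong (risingFrom? (y ∷ v) ∘ Vec.map suc) (risingFrom? v) (words n (2 + j))
          (λ { (_ ∷ _ ∷ _) (p , q) → suc-injective p , Rising-suc⁻ q })
          (λ { (_ ∷ _ ∷ _) (p , q) → cong suc p , Rising-suc⁺ q }))
        (count-risingFrom j v)))
    where
    first : ∀ {n} (v : Vec ℕ n) →
      count (risingFrom? (y ∷ v) ∘ (zero ∷_) ∘ Vec.map suc) (words n (suc j)) ≡ rises-at j y (toList v)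
    first [] = refl
    first {suc n} (b ∷ v) = trans
      (count-words-suc n j (risingFrom? (y ∷ b ∷ v) ∘ (zero ∷_) ∘ Vec.map suc)
        (λ { q i (_ , _ ∷ p) → Rising-nonzero (Rising-suc⁻ {i = q ∷ i} p) }))
      (trans (cong₂ _+_
        (trans
          (count-when (risingFrom? (y ∷ b ∷ v) ∘ (zero ∷_) ∘ Vec.map suc ∘ (zero ∷_) ∘ Vec.map suc)
            (y <? b)
            (risingAbove? v b) (words n j)
            (λ i (_ , p) → let q , r = Rising-zero⁻ p in VecAll.head q , Rising-zero⁻ r)
            (λ i p q → refl ,
              Rising-zero⁺ (p ∷ VecAll.map⁺ (VecAll.map (<-trans p) (proj₁ q)) , Rising-zero⁺ q)))
          (cong (when (y <? b)) (count-risingAbove j v b)))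
        -- After first position 0, adjacency leaves only position 1 for the second.
        (count-none (risingFrom? (y ∷ b ∷ v) ∘ (zero ∷_) ∘ Vec.map suc ∘ Vec.map suc) (words n (suc j))
          (λ { (_ ∷ _) (() , _) })))
        (+-identityʳ _))

  allPairs-lookup⁺ : ∀ {A : Set} {R : A → A → Set} {n} {v : Vec A n} → VecAllPairs.AllPairs R v →
    ∀ a b → a Fin.< b → R (lookup v a) (lookup v b)
  allPairs-lookup⁺ (p ∷ _)  zero    (suc b) _ = VecAll.lookup⁺ p b
  allPairs-lookup⁺ (_ ∷ ps) (suc a) (suc b) q = allPairs-lookup⁺ ps a b (s<s⁻¹ q)

  allPairs-lookup⁻ : ∀ {A : Set} {R : A → A → Set} {n} {v : Vec A n} →
    (∀ a b → a Fin.< b → R (lookup v a) (lookup v b)) → VecAllPairs.AllPairs R v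
  allPairs-lookup⁻ {v = []}    p = []
  allPairs-lookup⁻ {v = _ ∷ _} p =
    VecAll.lookup⁻ (λ b → p zero (suc b) z<s) ∷ allPairs-lookup⁻ (λ a b q → p (suc a) (suc b) (s<s q))

  allPairs-toList⁺ : ∀ {A : Set} {R : A → A → Set} {n} {v : Vec A n} →
    VecAllPairs.AllPairs R v → AllPairs R (toList v)
  allPairs-toList⁺ []       = []
  allPairs-toList⁺ (p ∷ ps) = VecAll.toList⁺ p ∷ allPairs-toList⁺ ps

  allPairs-toList⁻ : ∀ {A : Set} {R : A → A → Set} {n} {v : Vec A n} →
    AllPairs R (toList v) → VecAllPairs.AllPairs R v
  allPairs-toList⁻ {v = []}    []       = []
  allPairs-toList⁻ {v = _ ∷ _} (p ∷ ps) = VecAll.toList⁻ p ∷ allPairs-toList⁻ ps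

  oneLine : ∀ {m n} → Vec (Fin m) n → List ℕ
  oneLine π = toList (Vec.map toℕ π)

  module _ {n j : ℕ} (π : Vec (Fin n) n) where

    private
      v = Vec.map toℕ π
      τ = 12-3-⋯-k (2 + j)

    occurrence⇒risingFrom : ∀ i → IsOccurrence τ π i → RisingFrom v i
    occurrence⇒risingFrom i@(p ∷ q ∷ _) (inc , iso , adj) =
      adj zero (suc zero) refl refl ,
      allPairs-lookup⁻ λ a b a<b → inc a b a<b ,
        subst₂ _<_ (sym (lookup-map (lookup i a) toℕ π)) (sym (lookup-map (lookup i b) toℕ π))
          (proj₁ (iso a b) (subst₂ Fin._<_ (sym (lookup-allFin a)) (sym (lookup-allFin b)) a<b))

    risingFrom⇒occurrence : ∀ i → RisingFrom v i → IsOccurrence τ π i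
    risingFrom⇒occurrence i@(p ∷ q ∷ _) (adj , rising) =
      (λ a b a<b → proj₁ (rise a b a<b)) ,
      (λ a b → (λ lt → mono a b (subst₂ Fin._<_ (lookup-allFin a) (lookup-allFin b) lt)) ,
        λ lt → subst₂ Fin._<_ (sym (lookup-allFin a)) (sym (lookup-allFin b)) (reflect a b lt)) ,
      λ { zero (suc zero) _ _ → adj }
      where
      rise : ∀ a b → a Fin.< b → Rise v (lookup i a) (lookup i b)
      rise = allPairs-lookup⁺ rising
      mono : ∀ a b → a Fin.< b → lookup π (lookup i a) Fin.< lookup π (lookup i b)
      mono a b a<b = subst₂ _<_ (lookup-map (lookup i a) toℕ π) (lookup-map (lookup i b) toℕ π)
        (proj₂ (rise a b a<b))
      reflect : ∀ a b → lookup π (lookup i a) Fin.< lookup π (lookup i b) → a Fin.< b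
      -- A strictly monotone map out of a total order reflects the order.
      reflect a b lt = ≰⇒> λ b≤a → case b≤a
        where
        case : toℕ b ≤ toℕ a → ⊥
        case b≤a with m≤n⇒m<n∨m≡n b≤a
        ... | inj₁ b<a = <-asym lt (mono b a b<a)
        ... | inj₂ eq with refl ← Fin.toℕ-injective eq = <-irrefl refl lt

    occurrences≡rises : occurrences τ π ≡ rises j (oneLine π)
    occurrences≡rises = trans
      (count-cong (isOccurrence? τ π) (risingFrom? v) (words n (2 + j))
        occurrence⇒risingFrom risingFrom⇒occurrence)
      (count-risingFrom j v)

  -- The bijection between avoiding permutations and trees

  ∈-words : ∀ {m n} (w : Vec (Fin m) n) → w ∈ words m n
  ∈-words []      = here refl
  ∈-words (a ∷ w) = ∈-cartesianProductWith⁺ _∷_ (∈-allFin a) (∈-words w)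

  No132 : ∀ {n} → Vec ℕ n → Set
  No132 v = ∀ p q s → p Fin.< q → q Fin.< s → lookup v p < lookup v s → lookup v s < lookup v q → ⊥

  no132⇒avoids : ∀ {n} (v : Vec ℕ n) → No132 v → Avoids (toList v)
  no132⇒avoids []      h = _
  no132⇒avoids (a ∷ v) h =
    allPairs-toList⁺ (allPairs-lookup⁻ λ q s q<s (x , y) → h zero (suc q) (suc s) z<s (s<s q<s) x y) ,
    no132⇒avoids v (λ p q s x y → h (suc p) (suc q) (suc s) (s<s x) (s<s y))

  avoids⇒no132 : ∀ {n} (v : Vec ℕ n) → Avoids (toList v) → No132 v
  avoids⇒no132 (a ∷ v) (av , _) zero (suc q) (suc s) _ q<s x y =
    allPairs-lookup⁺ (allPairs-toList⁻ {v = v} av) q s (s<s⁻¹ q<s) (x , y)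
  avoids⇒no132 (a ∷ v) (_ , av) (suc p) (suc q) (suc s) p<q q<s =
    avoids⇒no132 v av p q s (s<s⁻¹ p<q) (s<s⁻¹ q<s)

  module _ {n : ℕ} (π : Vec (Fin n) n) where

    private
      v = Vec.map toℕ π

    no132⇒no-occurrence : No132 v → ∀ i → ¬ IsOccurrence 1-3-2 π i
    no132⇒no-occurrence h (p ∷ q ∷ s ∷ []) (inc , iso , _) =
      h p q s (inc zero (suc zero) z<s) (inc (suc zero) (suc (suc zero)) (s<s z<s))
        (rise p s (proj₁ (iso zero (suc (suc zero))) z<s))
        (rise s q (proj₁ (iso (suc (suc zero)) (suc zero)) (s<s z<s)))
      where
      rise : ∀ p q → lookup π p Fin.< lookup π q → lookup v p < lookup v q
      rise p q = subst₂ _<_ (sym (lookup-map p toℕ π)) (sym (lookup-map q toℕ π))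

    no-occurrence⇒no132 : (∀ i → ¬ IsOccurrence 1-3-2 π i) → No132 v
    no-occurrence⇒no132 h p q s p<q q<s vp<vs vs<vq = h (p ∷ q ∷ s ∷ []) (inc , iso , λ _ _ _ ())
      where
      rise : ∀ p q → lookup v p < lookup v q → lookup π p Fin.< lookup π q
      rise p q = subst₂ _<_ (lookup-map p toℕ π) (lookup-map q toℕ π)
      πp<πs = rise p s vp<vs
      πs<πq = rise s q vs<vq
      πp<πq = <-trans πp<πs πs<πq
      inc : ∀ a b → a Fin.< b → lookup (p ∷ q ∷ s ∷ []) a Fin.< lookup (p ∷ q ∷ s ∷ []) b
      inc zero       (suc zero)       _ = p<q
      inc zero       (suc (suc zero)) _ = <-trans p<q q<s
      inc (suc zero) (suc (suc zero)) _ = q<s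
      inc (suc zero) (suc zero)       (s≤s ())
      inc (suc (suc zero)) (suc zero)       (s≤s ())
      inc (suc (suc zero)) (suc (suc zero)) (s≤s (s≤s ()))
      iso : ∀ a b → _
      iso zero zero = (λ ()) , ⊥-elim ∘ <-irrefl refl
      iso zero (suc zero) = (λ _ → πp<πq) , λ _ → z<s
      iso zero (suc (suc zero)) = (λ _ → πp<πs) , λ _ → z<s
      iso (suc zero) zero = (λ ()) , ⊥-elim ∘ <-asym πp<πq
      iso (suc zero) (suc zero) = ⊥-elim ∘ <-irrefl refl , ⊥-elim ∘ <-irrefl refl
      iso (suc zero) (suc (suc zero)) = (λ { (s≤s ()) }) , ⊥-elim ∘ <-asym πs<πq
      iso (suc (suc zero)) zero = (λ ()) , ⊥-elim ∘ <-asym πp<πs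
      iso (suc (suc zero)) (suc zero) = (λ _ → πs<πq) , λ _ → s<s z<s
      iso (suc (suc zero)) (suc (suc zero)) = ⊥-elim ∘ <-irrefl refl , ⊥-elim ∘ <-irrefl refl

    avoids⇒occurrences≡0 : Avoids (oneLine π) → occurrences 1-3-2 π ≡ 0
    avoids⇒occurrences≡0 av =
      count-none (isOccurrence? 1-3-2 π) (words n 3) (no132⇒no-occurrence (avoids⇒no132 v av))

    occurrences≡0⇒avoids : occurrences 1-3-2 π ≡ 0 → Avoids (oneLine π)
    occurrences≡0⇒avoids eq = no132⇒avoids v (no-occurrence⇒no132 λ i occ →
      <-irrefl (sym eq) (filter-some (isOccurrence? 1-3-2 π) (lose (∈-words i) occ)))

  words-unique : ∀ m n → Unique (words m n)
  words-unique m zero    = [] ∷ []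
  words-unique m (suc n) =
    Unique.cartesianProductWith⁺ _∷_ (λ { refl → refl , refl }) (Unique.allFin⁺ m) (words-unique m n)

  oneLine-injective : ∀ {m n} (π ρ : Vec (Fin m) n) → oneLine π ≡ oneLine ρ → π ≡ ρ
  oneLine-injective []      []      _  = refl
  oneLine-injective (a ∷ π) (b ∷ ρ) eq = cong₂ _∷_
    (Fin.toℕ-injective (List.∷-injectiveˡ eq)) (oneLine-injective π ρ (List.∷-injectiveʳ eq))

  oneLine-unique⁺ : ∀ {m n} {π : Vec (Fin m) n} → Vec.Unique π → Unique (oneLine π)
  oneLine-unique⁺ u =
    allPairs-toList⁺ (VecAllPairs.map⁺ (VecAllPairs.map (_∘ Fin.toℕ-injective) u))

  oneLine-unique⁻ : ∀ {m n} {π : Vec (Fin m) n} → Unique (oneLine π) → Vec.Unique π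
  oneLine-unique⁻ {π = π} u = allPairs-map⁻ (allPairs-toList⁻ u)
    where
    allPairs-map⁻ : ∀ {m n} {π : Vec (Fin m) n} → Vec.Unique (Vec.map toℕ π) → Vec.Unique π
    allPairs-map⁻ {π = []}    []       = []
    allPairs-map⁻ {π = _ ∷ _} (p ∷ ps) = VecAll.map (_∘ cong toℕ) (VecAll.map⁻ p) ∷ allPairs-map⁻ ps

  oneLine-bound : ∀ {m n} (π : Vec (Fin m) n) → All (Between 0 m) (oneLine π)
  oneLine-bound []      = []
  oneLine-bound (a ∷ π) = (z≤n , Fin.toℕ<n a) ∷ oneLine-bound π

  oneLine-surjective : ∀ {m} w → All (Between 0 m) w → ∃[ π ] oneLine {m} {length w} π ≡ w
  oneLine-surjective []      []            = [] , refl
  oneLine-surjective (a ∷ w) ((_ , p) ∷ b) with π , eq ← oneLine-surjective w b =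
    fromℕ< p ∷ π , cong₂ _∷_ (Fin.toℕ-fromℕ< p) eq

  length-oneLine : ∀ {m n} (π : Vec (Fin m) n) → length (oneLine π) ≡ n
  length-oneLine π = length-toList (Vec.map toℕ π)

  tree⇒permutation : ∀ t → ∃[ π ] oneLine {size t} {size t} π ≡ word 0 t
  tree⇒permutation t = subst (λ n → ∃[ π ] oneLine {size t} {n} π ≡ word 0 t) (length-word 0 t)
    (oneLine-surjective (word 0 t) (word-between 0 t))

  permutation⇒tree : ∀ {n} (π : Vec (Fin n) n) → Vec.Unique π → Avoids (oneLine π) →
    ∃[ t ] word 0 t ≡ oneLine π
  permutation⇒tree {n} π u av = word-surjective n 0 (oneLine π) (≤-reflexive (length-oneLine π))
    (oneLine-unique⁺ u)
    (subst (λ k → All (Between 0 k) (oneLine π)) (sym (length-oneLine π)) (oneLine-bound π)) av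

  module _ (j r n : ℕ) where

    private
      τ = 12-3-⋯-k (2 + j)

      tree? = λ t → c (suc j) t ≟ r

      Counted : Vec (Fin n) n → Set
      Counted π = Vec.Unique π × occurrences 1-3-2 π ≡ 0 × occurrences τ π ≡ r

      counted? : ∀ π → Dec (Counted π)
      counted? π = unique? π ×-dec (occurrences 1-3-2 π ≟ 0) ×-dec (occurrences τ π ≟ r)

      stat : ∀ (π : Vec (Fin n) n) t → word 0 t ≡ oneLine π → occurrences τ π ≡ c (suc j) t
      stat π t eq = trans (occurrences≡rises π) (trans (cong (rises j) (sym eq)) (rises-word j 0 t))

      to : ∀ π → Counted π → oneLine π ∈ List.map (word 0) (filter tree? (trees n))
      to π (u , av , occ) =
        let t , eq = permutation⇒tree π u (occurrences≡0⇒avoids π av)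
            size≡n = trans (sym (length-word 0 t)) (trans (cong length eq) (length-oneLine π))
        in subst (_∈ List.map (word 0) (filter tree? (trees n))) eq (∈-map⁺ (word 0) (∈-filter⁺ tree?
             (subst (λ k → t ∈ treesWithin n k) size≡n (∈-treesWithin⁺ n t (≤-reflexive size≡n)))
             (trans (sym (stat π t eq)) occ)))

      from : ∀ t → size t ≡ n → c (suc j) t ≡ r →
        word 0 t ∈ List.map oneLine (filter counted? (words n n))
      from t refl occ =
        let π , eq = tree⇒permutation t
        in subst (_∈ List.map oneLine (filter counted? (words n n))) eq
            (∈-map⁺ oneLine (∈-filter⁺ counted? (∈-words π)
            (oneLine-unique⁻ (subst Unique (sym eq) (Unique-word 0 t)) ,
             avoids⇒occurrences≡0 π (subst Avoids (sym eq) (Avoids-word 0 t)) ,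
             trans (stat π t (sym eq)) occ)))

      -- Permutations and trees are both sent injectively to words of natural numbers. The two
      -- images are duplicate-free lists with the same members, hence rearrangements of each other.
      count-counted : count counted? (words n n) ≡ count tree? (trees n)
      count-counted = begin
        count counted? (words n n)
          ≡⟨ length-map oneLine (filter counted? (words n n)) ⟨
        length (List.map oneLine (filter counted? (words n n)))
          ≡⟨ ↭-length (∼bag⇒↭ (unique∧set⇒bag
               (Unique.map⁺ (oneLine-injective _ _) (Unique.filter⁺ counted? (words-unique n n)))
               (Unique.map⁺ (word-injective 0 _ _) (Unique.filter⁺ tree? (treesWithin-unique n n)))
               (mk⇔
                 (λ w∈ → let π , π∈ , eq = ∈-map⁻ oneLine w∈ in
                    subst (_∈ _) (sym eq) (to π (proj₂ (∈-filter⁻ counted? {xs = words n n} π∈))))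
                 λ w∈ → let t , t∈ , eq = ∈-map⁻ (word 0) w∈
                            t∈n , occ = ∈-filter⁻ tree? {xs = trees n} t∈ in
                    subst (_∈ _) (sym eq) (from t (∈-treesWithin⁻ n n t∈n) occ)))) ⟩
        length (List.map (word 0) (filter tree? (trees n)))
          ≡⟨ length-map (word 0) (filter tree? (trees n)) ⟩
        count tree? (trees n) ∎
        where open ≡-Reasoning

    f≡count-trees : f (12-3-⋯-k (2 + j)) r n ≡ count (λ t → c (suc j) t ≟ r) (trees n)
    f≡count-trees = count-counted

open Combinatorics using
  (Tree; leaf; node; c; c-suc-positive; trees; treesWithin; nodes; trees-suc; count; f≡count-trees)

-- Generating functions

module TreeSeries {κ ℓ} (R : CommutativeRing κ ℓ) (q : CommutativeRing.Carrier R) where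
  open CommutativeRing R hiding (zero)
  open RawMonoidDefs +-rawMonoid using (sum)
  open Exp commutativeSemiring using (_^_; ^-homo-*)
  open PowerSeries R
  open NatSolver commutativeSemiring using (solve; _:+_; _:*_; _:=_; con)
  open SetoidReasoning setoid

  total : (Tree → Carrier) → List Tree → Carrier
  total w []       = 0#
  total w (t ∷ ts) = w t + total w ts

  series : (Tree → Carrier) → ℕ → Carrier
  series w n = total w (trees n)

  total-++ : ∀ w ts us → total w (ts ++ us) ≈ total w ts + total w us
  total-++ w []       us = sym (+-identityˡ _)
  total-++ w (t ∷ ts) us = trans (+-congˡ (total-++ w ts us)) (sym (+-assoc _ _ _))

  total-concat-tabulate : ∀ w {n} (g : Fin n → List Tree) →
    total w (concat (tabulate g)) ≈ sum λ i → total w (g i)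
  total-concat-tabulate w {zero}  g = refl
  total-concat-tabulate w {suc n} g =
    trans (total-++ w (g zero) _) (+-congˡ (total-concat-tabulate w (g ∘ suc)))

  module _ {w a b : Tree → Carrier} (w-node : ∀ l r → w (node l r) ≈ a l * b r) where

    total-map-node : ∀ l rs → total w (List.map (node l) rs) ≈ a l * total b rs
    total-map-node l []       = sym (zeroʳ _)
    total-map-node l (r ∷ rs) =
      trans (+-cong (w-node l r) (total-map-node l rs)) (sym (distribˡ _ _ _))

    total-node : ∀ ls rs → total w (cartesianProductWith node ls rs) ≈ total a ls * total b rs
    total-node []       rs = sym (zeroˡ _)
    total-node (l ∷ ls) rs = trans (total-++ w (List.map (node l) rs) _)
      (trans (+-cong (total-map-node l rs) (total-node ls rs)) (sym (distribʳ _ _ _)))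

    sum-cong : ∀ {n} {g h : Fin n → Carrier} → (∀ i → g i ≈ h i) → sum g ≈ sum h
    sum-cong {zero}  p = refl
    sum-cong {suc n} p = +-cong (p zero) (sum-cong (p ∘ suc))

    series-suc : ∀ n → series w (suc n) ≈ (series a ⊛ series b) n
    series-suc n = begin
      total w (trees (suc n))                      ≡⟨ ≡.cong (total w) (trees-suc n) ⟩
      total w (concat (tabulate (nodes trees n)))  ≈⟨ total-concat-tabulate w (nodes trees n) ⟩
      sum (λ i → total w (nodes trees n i))        ≈⟨ sum-cong {suc n} (λ i →
        total-node (trees (toℕ i)) (trees (n ∸ toℕ i))) ⟩
      (series a ⊛ series b) n                      ∎

    -- A tree of size n + 1 is a pair of subtrees whose sizes add up to n, so a weight that splits
    -- over the subtrees yields a Cauchy product.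
    series-node : series w ≐ const (w leaf) ⊕ X ⊛ (series a ⊛ series b)
    series-node = coefficientwise λ where
      zero    → +-congˡ (sym (X-⊛-zero (series a ⊛ series b)))
      (suc n) → trans (series-suc n)
        (trans (sym (X-⊛-suc (series a ⊛ series b) n)) (sym (+-identityˡ _)))

  guard : ℕ → Carrier → Carrier
  guard zero    u = u
  guard (suc _) u = 0#

  guard-suc : ∀ m n u → guard (m ℕ.+ suc n) u ≈ 0#
  guard-suc m n u = reflexive (≡.cong (λ k → guard k u) (ℕ.+-suc m n))

  guard-* : ∀ n u v → guard n (u * v) ≈ u * guard n v
  guard-* zero    u v = refl
  guard-* (suc n) u v = sym (zeroʳ u)

  -- The restriction c (suc j) t = 0 is what makes the weight multiplicative at a node.
  weight : ℕ → Tree → Carrier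
  weight j t = guard (c (suc j) t) (q ^ c j t)

  isLeaf : Tree → Carrier
  isLeaf leaf       = 1#
  isLeaf (node _ _) = 0#

  noRise : Tree → Carrier
  noRise t = guard (c 1 t) 1#

  -- The last letter of a nonempty left part forms a rise with the maximum.
  noRise-node : ∀ l r → noRise (node l r) ≈ isLeaf l * noRise r
  noRise-node leaf       r =
    trans (reflexive (≡.cong (λ k → guard k 1#) (ℕ.+-identityʳ (c 1 r)))) (sym (*-identityˡ _))
  noRise-node l@(node _ _) r = trans (guard-suc (c 1 l ℕ.+ c 1 r) 0 1#) (sym (zeroˡ _))

  -- `c 0` is 1 at every node, so the root carries the only factor q, and the subtrees are subject
  -- to the condition `c 1 = 0` alone.
  weight-zero-node : ∀ l r → weight 0 (node l r) ≈ (q * isLeaf l) * noRise r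
  weight-zero-node leaf       r = begin
    guard (c 1 r ℕ.+ 0) (q * 1#)  ≡⟨ ≡.cong (λ k → guard k (q * 1#)) (ℕ.+-identityʳ (c 1 r)) ⟩
    guard (c 1 r) (q * 1#)        ≈⟨ guard-* (c 1 r) q 1# ⟩
    q * noRise r                  ≈⟨ *-congʳ (*-identityʳ q) ⟨
    q * 1# * noRise r             ∎
  weight-zero-node l@(node _ _) r = trans (guard-suc (c 1 l ℕ.+ c 1 r) 0 (q ^ 1))
    (sym (trans (*-congʳ (zeroʳ q)) (zeroˡ _)))

  -- If `c (1 + j) l` is positive, both sides vanish. If it is 0, the exponent `c (1 + j)` of the
  -- node becomes `c j l + c (1 + j) r`, and `c-suc-positive` gives `c (2 + j) l = 0`, so the
  -- remaining condition concerns `r` alone.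
  weight-suc-node : ∀ j l r → weight (suc j) (node l r) ≈ weight j l * weight (suc j) r
  weight-suc-node j l r with c (suc j) l | c-suc-positive (suc j) l
  ... | suc m | _ = trans (guard-suc (c (2 ℕ.+ j) l ℕ.+ c (2 ℕ.+ j) r) m _) (sym (zeroˡ _))
  ... | zero  | positive with c (2 ℕ.+ j) l
  ... | suc _ with () ← positive (ℕ.s≤s ℕ.z≤n)
  ... | zero = begin
    guard (c (2 ℕ.+ j) r ℕ.+ 0) (q ^ (c (suc j) r ℕ.+ c j l))
      ≡⟨ ≡.cong₂ (λ m n → guard m (q ^ n)) (ℕ.+-identityʳ (c (2 ℕ.+ j) r)) (ℕ.+-comm (c (suc j) r) _) ⟩
    guard (c (2 ℕ.+ j) r) (q ^ (c j l ℕ.+ c (suc j) r))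
      ≈⟨ guard-cong (c (2 ℕ.+ j) r) (^-homo-* q (c j l) _) ⟩
    guard (c (2 ℕ.+ j) r) (q ^ c j l * q ^ c (suc j) r)
      ≈⟨ guard-* (c (2 ℕ.+ j) r) _ _ ⟩
    q ^ c j l * weight (suc j) r ∎
    where
    guard-cong : ∀ n {u v} → u ≈ v → guard n u ≈ guard n v
    guard-cong zero    p = p
    guard-cong (suc _) p = refl

  total-0 : ∀ ts → total (λ _ → 0#) ts ≈ 0#
  total-0 []       = refl
  total-0 (_ ∷ ts) = trans (+-identityˡ _) (total-0 ts)

  series-isLeaf : series isLeaf ≐ const 1#
  series-isLeaf = coefficientwise λ where
    zero    → +-identityʳ _
    -- `isLeaf` is 0 at a node, which is a product of two zero weights.
    (suc n) → trans (series-suc {isLeaf} {λ _ → 0#} {λ _ → 0#} (λ l r → sym (zeroˡ _)) n)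
      (trans (⊛-cong {b = series (λ _ → 0#)} {b′ = series (λ _ → 0#)} (total-0 ∘ trees) (λ _ → refl) n)
        (⊛-zeroˡ (series (λ _ → 0#)) n))

  series-* : ∀ u w → series (λ t → u * w t) ≐ const u ⊛ series w
  series-* u w = coefficientwise λ n → trans (total-* (trees n)) (sym (const-⊛ u (series w) n))
    where
    total-* : ∀ ts → total (λ t → u * w t) ts ≈ u * total w ts
    total-* []       = sym (zeroʳ u)
    total-* (_ ∷ ts) = trans (+-congˡ (total-* ts)) (sym (distribˡ _ _ _))

  private
    module S = CommutativeRing commutativeRing

  H : ℕ → ℕ → Carrier
  H j = series (weight j)

  -- The geometric series 1/(1 - x): there is one decreasing word of each length.
  Z : ℕ → Carrier
  Z = series noRise

  Z-equation : Z ≐ S.1# ⊕ X ⊛ Z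
  Z-equation = S.trans (series-node noRise-node)
    (S.+-congˡ (S.*-congˡ {X} (S.trans (S.*-congʳ {Z} series-isLeaf) (S.*-identityˡ Z))))

  H-zero : H 0 ≐ S.1# ⊕ X ⊛ (const q ⊛ Z)
  H-zero = S.trans (series-node weight-zero-node)
    (S.+-congˡ (S.*-congˡ {X} (S.*-congʳ {Z} (S.trans (series-* q isLeaf)
      (S.trans (S.*-congˡ {const q} series-isLeaf) (S.*-identityʳ (const q)))))))

  H-suc : ∀ j → H (suc j) ≐ S.1# ⊕ X ⊛ (H j ⊛ H (suc j))
  H-suc j = series-node (weight-suc-node j)

-- The continued fraction and its convergents

module ContinuedFraction {κ ℓ} (A : CommutativeRing κ ℓ) (x : CommutativeRing.Carrier A) where
  open CommutativeRing A hiding (zero)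
  open Exp commutativeSemiring using (_^_)
  open NatSolver commutativeSemiring using (solve; _:+_; _:*_; _:=_; con)
  open SetoidReasoning setoid

  -- P j is x^(j/2) U_j(1/(2√x)).
  P : ℕ → Carrier
  P zero          = 1#
  P (suc zero)    = 1#
  P (suc (suc j)) = P (suc j) + - x * P j

  -- The polynomial identities below treat `- x` as a variable independent of `x`. Every
  -- cancellation of one against the other, here and in `ClosedForm`, passes through this lemma.
  cancel : ∀ a b → a + - x * b + x * b ≈ a
  cancel a b = begin
    a + - x * b + x * b
      ≈⟨ solve 4 (λ a m x b → a :+ m :* b :+ x :* b := a :+ (m :+ x) :* b) refl a (- x) x b ⟩
    a + (- x + x) * b
      ≈⟨ +-congˡ (trans (*-congʳ (-‿inverseˡ x)) (zeroˡ b)) ⟩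
    a + 0#
      ≈⟨ +-identityʳ a ⟩
    a ∎

  move : ∀ {a b d} → a + - x * b ≈ d → a ≈ d + x * b
  move {a} {b} p = trans (sym (cancel a b)) (+-congʳ p)

  -- Solves (1 - x e) z = d, with e = 1 for the series `Z` and e = `H j` for `H (suc j)`.
  geometric : ∀ {z d e} → z ≈ d + x * (e * z) → z + - x * (e * z) ≈ d
  geometric {z} {d} {e} p = begin
    z + - x * (e * z)
      ≈⟨ +-congʳ p ⟩
    d + x * (e * z) + - x * (e * z)
      ≈⟨ solve 4 (λ d x y m → d :+ x :* y :+ m :* y := d :+ m :* y :+ x :* y)
           refl d x (e * z) (- x) ⟩
    d + - x * (e * z) + x * (e * z)
      ≈⟨ cancel d (e * z) ⟩
    d ∎

  -- Expanding P_{j+4} and P_{j+2} by the recurrence shows that P_{j+3} P_{j+2} - P_{j+4} P_{j+1} is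
  -- x times the same difference one index lower. For Chebyshev polynomials this is U_{j+2} U_{j+1}
  -- - U_{j+3} U_j = U_1.
  cassini : ∀ j → P (3 ℕ.+ j) * P j + x ^ (1 ℕ.+ j) ≈ P (2 ℕ.+ j) * P (1 ℕ.+ j)
  cassini zero = begin
    (1# + - x * 1# + - x * 1#) * 1# + x * 1#
      ≈⟨ solve 2 (λ m x → (con 1 :+ m :* con 1 :+ m :* con 1) :* con 1 :+ x :* con 1 :=
                          con 1 :+ m :* con 1 :+ m :* con 1 :+ x :* con 1) refl (- x) x ⟩
    1# + - x * 1# + - x * 1# + x * 1#  ≈⟨ cancel (1# + - x * 1#) 1# ⟩
    1# + - x * 1#                      ≈⟨ *-identityʳ _ ⟨
    (1# + - x * 1#) * 1#               ∎
  cassini (suc j) = begin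
    (P₃ + - x * P₂) * P₁ + x * xʲ
      ≈⟨ solve 6 (λ P₃ P₂ P₁ m x y → (P₃ :+ m :* P₂) :* P₁ :+ x :* y :=
           P₃ :* P₁ :+ m :* (P₂ :* P₁) :+ x :* y) refl P₃ P₂ P₁ (- x) x xʲ ⟩
    P₃ * P₁ + - x * (P₂ * P₁) + x * xʲ
      ≈⟨ +-congʳ (+-congˡ (*-congˡ (cassini j))) ⟨
    P₃ * P₁ + - x * (P₃ * P₀ + xʲ) + x * xʲ
      ≈⟨ solve 6 (λ P₃ P₁ P₀ m x y → P₃ :* P₁ :+ m :* (P₃ :* P₀ :+ y) :+ x :* y :=
           P₃ :* (P₁ :+ m :* P₀) :+ m :* y :+ x :* y) refl P₃ P₁ P₀ (- x) x xʲ ⟩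
    P₃ * (P₁ + - x * P₀) + - x * xʲ + x * xʲ
      ≈⟨ cancel _ xʲ ⟩
    P₃ * P₂ ∎
    where
    P₀ = P j ; P₁ = P (1 ℕ.+ j) ; P₂ = P (2 ℕ.+ j) ; P₃ = P (3 ℕ.+ j)
    xʲ = x ^ (1 ℕ.+ j)

  module _ {Q Z : Carrier} {H : ℕ → Carrier}
    (Z-eq : Z ≈ 1# + x * Z) (H-zero : H 0 ≈ 1# + x * (Q * Z))
    (H-suc : ∀ j → H (suc j) ≈ 1# + x * (H j * H (suc j))) where

    -- Numerators and denominators of the convergents of the continued fraction
    -- H (suc j) = 1 / (1 - x H j).
    D : ℕ → Carrier
    D zero          = 1# + - x + Q * x
    D (suc zero)    = 1# + - x
    D (suc (suc j)) = D (suc j) + - x * D j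

    -- `D 0` and `D 1` are chosen with quotient H_0 = 1 + q x/(1 - x). Then D_{j+2} H_{j+1} =
    -- D_{j+1} (1 - x H_j) H_{j+1} = D_{j+1}.
    D-H : ∀ j → D (suc j) * H j ≈ D j
    D-H zero = begin
      (1# + - x) * H 0
        ≈⟨ *-congˡ H-zero ⟩
      (1# + - x) * (1# + x * (Q * Z))
        ≈⟨ solve 4 (λ m x q z → (con 1 :+ m) :* (con 1 :+ x :* (q :* z)) :=
             con 1 :+ m :+ q :* x :* (z :+ m :* (con 1 :* z))) refl (- x) x Q Z ⟩
      1# + - x + Q * x * (Z + - x * (1# * Z))
        ≈⟨ +-congˡ (*-congˡ (geometric (trans Z-eq (+-congˡ (*-congˡ (sym (*-identityˡ Z))))))) ⟩
      1# + - x + Q * x * 1#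
        ≈⟨ +-congˡ (*-identityʳ _) ⟩
      D 0 ∎
    D-H (suc j) = begin
      (D (suc j) + - x * D j) * H (suc j)
        ≈⟨ *-congʳ (+-congˡ (*-congˡ (D-H j))) ⟨
      (D (suc j) + - x * (D (suc j) * H j)) * H (suc j)
        ≈⟨ solve 4 (λ d m h h′ → (d :+ m :* (d :* h)) :* h′ := d :* (h′ :+ m :* (h :* h′)))
             refl (D (suc j)) (- x) (H j) (H (suc j)) ⟩
      D (suc j) * (H (suc j) + - x * (H j * H (suc j)))
        ≈⟨ *-congˡ (geometric (H-suc j)) ⟩
      D (suc j) * 1#
        ≈⟨ *-identityʳ _ ⟩
      D (suc j) ∎

    -- Both sides satisfy the recurrence of `P`, so it suffices to compare two initial values.
    D-P : ∀ j → D (2 ℕ.+ j) ≈ P (2 ℕ.+ j) + - x * P (2 ℕ.+ j) + Q * (- x * (x * P j))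
    D-P zero = solve 3 (λ m x q → con 1 :+ m :+ m :* (con 1 :+ m :+ q :* x) :=
      con 1 :+ m :* con 1 :+ m :* (con 1 :+ m :* con 1) :+ q :* (m :* (x :* con 1))) refl (- x) x Q
    D-P (suc zero) = solve 3 (λ m x q →
      con 1 :+ m :+ m :* (con 1 :+ m :+ q :* x) :+ m :* (con 1 :+ m) :=
      con 1 :+ m :* con 1 :+ m :* con 1 :+ m :* (con 1 :+ m :* con 1 :+ m :* con 1) :+
      q :* (m :* (x :* con 1))) refl (- x) x Q
    D-P (suc (suc j)) = begin
      D (3 ℕ.+ j) + - x * D (2 ℕ.+ j)
        ≈⟨ +-cong (D-P (suc j)) (*-congˡ (D-P j)) ⟩
      P₃ + - x * P₃ + Q * (- x * (x * P (suc j))) + - x * (P₂ + - x * P₂ + Q * (- x * (x * P j)))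
        ≈⟨ solve 7 (λ P₃ P₂ P₁ P₀ m x q →
             P₃ :+ m :* P₃ :+ q :* (m :* (x :* P₁)) :+ m :* (P₂ :+ m :* P₂ :+ q :* (m :* (x :* P₀))) :=
             P₃ :+ m :* P₂ :+ m :* (P₃ :+ m :* P₂) :+ q :* (m :* (x :* (P₁ :+ m :* P₀))))
             refl P₃ P₂ (P (suc j)) (P j) (- x) x Q ⟩
      P (4 ℕ.+ j) + - x * P (4 ℕ.+ j) + Q * (- x * (x * P (2 ℕ.+ j))) ∎
      where P₂ = P (2 ℕ.+ j) ; P₃ = P (3 ℕ.+ j)

    -- Both sides are multiplied out to the same shape, the right one with 1 in place of `h`, so
    -- that coefficients of q are extracted from both by one lemma.
    H-equation : ∀ j → let h = H (2 ℕ.+ j) in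
      P (3 ℕ.+ j) * h + - x * (P (3 ℕ.+ j) * h) + Q * (- x * (x * (P (1 ℕ.+ j) * h))) ≈
      P (2 ℕ.+ j) * 1# + - x * (P (2 ℕ.+ j) * 1#) + Q * (- x * (x * (P j * 1#)))
    H-equation j = begin
      P₃ * h + - x * (P₃ * h) + Q * (- x * (x * (P₁ * h)))
        ≈⟨ solve 6 (λ P₃ P₁ h m x q → P₃ :* h :+ m :* (P₃ :* h) :+ q :* (m :* (x :* (P₁ :* h))) :=
             (P₃ :+ m :* P₃ :+ q :* (m :* (x :* P₁))) :* h) refl P₃ P₁ h (- x) x Q ⟩
      (P₃ + - x * P₃ + Q * (- x * (x * P₁))) * h
        ≈⟨ *-congʳ (D-P (1 ℕ.+ j)) ⟨
      D (3 ℕ.+ j) * h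
        ≈⟨ D-H (2 ℕ.+ j) ⟩
      D (2 ℕ.+ j)
        ≈⟨ D-P j ⟩
      P₂ + - x * P₂ + Q * (- x * (x * P₀))
        ≈⟨ solve 5 (λ P₂ P₀ m x q → P₂ :+ m :* P₂ :+ q :* (m :* (x :* P₀)) :=
             P₂ :* con 1 :+ m :* (P₂ :* con 1) :+ q :* (m :* (x :* (P₀ :* con 1))))
             refl P₂ P₀ (- x) x Q ⟩
      P₂ * 1# + - x * (P₂ * 1#) + Q * (- x * (x * (P₀ * 1#))) ∎
      where
      h = H (2 ℕ.+ j)
      P₀ = P j ; P₁ = P (1 ℕ.+ j) ; P₂ = P (2 ℕ.+ j) ; P₃ = P (3 ℕ.+ j)

module ClosedForm {κ ℓ} (B : CommutativeRing κ ℓ) (x : CommutativeRing.Carrier B) where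
  open CommutativeRing B hiding (zero)
  open ContinuedFraction B x
  open Exp commutativeSemiring using (_^_)
  open NatSolver commutativeSemiring using (solve; _:+_; _:*_; _:=_; con)
  open SetoidReasoning setoid

  move-zero : ∀ {a b} → a + - x * (x * b) ≈ 0# → a ≈ x * x * b
  move-zero {a} {b} p = trans (move p) (trans (+-identityˡ _) (sym (*-assoc x x b)))

  module _ {Z : Carrier} (Z-eq : Z ≈ 1# + x * Z) where

    -- `Z` is an inverse of 1 - x, so the factor can be cancelled in any commutative ring.
    cancel-1-x : ∀ {a b} → a + - x * a ≈ b + - x * b → a ≈ b
    cancel-1-x {a} {b} p = trans (sym (Z-* a)) (trans (*-congˡ p) (Z-* b))
      where
      Z-* : ∀ a → Z * (a + - x * a) ≈ a
      Z-* a = begin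
        Z * (a + - x * a)
          ≈⟨ solve 3 (λ z a m → z :* (a :+ m :* a) := a :* (z :+ m :* (con 1 :* z)))
               refl Z a (- x) ⟩
        a * (Z + - x * (1# * Z))
          ≈⟨ *-congˡ (geometric (trans Z-eq (+-congˡ (*-congˡ (sym (*-identityˡ Z)))))) ⟩
        a * 1#
          ≈⟨ *-identityʳ a ⟩
        a ∎

    module _ (j : ℕ) {G : ℕ → Carrier}
      (e₀ : P (3 ℕ.+ j) * G 0 + - x * (P (3 ℕ.+ j) * G 0) ≈ P (2 ℕ.+ j) + - x * P (2 ℕ.+ j))
      (e₁ : P (3 ℕ.+ j) * G 1 + - x * (P (3 ℕ.+ j) * G 1) + - x * (x * (P (1 ℕ.+ j) * G 0)) ≈
            - x * (x * P j))
      (e₂ : ∀ r → P (3 ℕ.+ j) * G (2 ℕ.+ r) + - x * (P (3 ℕ.+ j) * G (2 ℕ.+ r)) +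
                  - x * (x * (P (1 ℕ.+ j) * G (1 ℕ.+ r))) ≈ 0#)
      where

      private
        k = 3 ℕ.+ j

      G-zero : P k * G 0 ≈ P (2 ℕ.+ j)
      G-zero = cancel-1-x e₀

      -- Each further coefficient is x² P_{k-2} / ((1 - x) P_k) times the one before. For the first,
      -- inserting G_0 = P_{k-1} / P_k leaves x² (P_{k-1} P_{k-2} - P_k P_{k-3}), which Cassini's
      -- identity turns into x^k.
      G-suc : ∀ r → (1# + - x) ^ (1 ℕ.+ r) * P k ^ (2 ℕ.+ r) * G (1 ℕ.+ r) ≈
                    x ^ (2 ℕ.* r ℕ.+ k) * P (1 ℕ.+ j) ^ r
      G-suc zero = begin
        (1# + - x) * 1# * (P k * (P k * 1#)) * G 1
          ≈⟨ solve 3 (λ m p g → (con 1 :+ m) :* con 1 :* (p :* (p :* con 1)) :* g :=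
               p :* (p :* g :+ m :* (p :* g))) refl (- x) (P k) (G 1) ⟩
        P k * (P k * G 1 + - x * (P k * G 1))
          ≈⟨ *-congˡ (move e₁) ⟩
        P k * (- x * (x * P j) + x * (x * (P (1 ℕ.+ j) * G 0)))
          ≈⟨ solve 6 (λ p m x p₀ p₁ g → p :* (m :* (x :* p₀) :+ x :* (x :* (p₁ :* g))) :=
               x :* (m :* (p :* p₀) :+ x :* ((p :* g) :* p₁)))
               refl (P k) (- x) x (P j) (P (1 ℕ.+ j)) (G 0) ⟩
        x * (- x * (P k * P j) + x * ((P k * G 0) * P (1 ℕ.+ j)))
          ≈⟨ *-congˡ (+-congˡ (*-congˡ (trans (*-congʳ G-zero) (sym (cassini j))))) ⟩
        x * (- x * (P k * P j) + x * (P k * P j + x ^ (1 ℕ.+ j)))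
          ≈⟨ *-congˡ (solve 4 (λ m x y z → m :* y :+ x :* (y :+ z) := x :* z :+ m :* y :+ x :* y)
               refl (- x) x (P k * P j) (x ^ (1 ℕ.+ j))) ⟩
        x * (x * x ^ (1 ℕ.+ j) + - x * (P k * P j) + x * (P k * P j))
          ≈⟨ *-congˡ (cancel (x * x ^ (1 ℕ.+ j)) (P k * P j)) ⟩
        x * (x * x ^ (1 ℕ.+ j))
          ≈⟨ *-identityʳ _ ⟨
        x ^ k * 1# ∎
      G-suc (suc r) = begin
        (1# + - x) * (1# + - x) ^ (1 ℕ.+ r) * (P k * P k ^ (2 ℕ.+ r)) * G (2 ℕ.+ r)
          ≈⟨ solve 5 (λ m u p v g → (con 1 :+ m) :* u :* (p :* v) :* g :=
               u :* v :* (p :* g :+ m :* (p :* g)))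
               refl (- x) ((1# + - x) ^ (1 ℕ.+ r)) (P k) (P k ^ (2 ℕ.+ r)) (G (2 ℕ.+ r)) ⟩
        (1# + - x) ^ (1 ℕ.+ r) * P k ^ (2 ℕ.+ r) * (P k * G (2 ℕ.+ r) + - x * (P k * G (2 ℕ.+ r)))
          ≈⟨ *-congˡ (move-zero (e₂ r)) ⟩
        (1# + - x) ^ (1 ℕ.+ r) * P k ^ (2 ℕ.+ r) * (x * x * (P (1 ℕ.+ j) * G (1 ℕ.+ r)))
          ≈⟨ solve 5 (λ u v x p g → u :* v :* (x :* x :* (p :* g)) := x :* x :* p :* (u :* v :* g))
               refl ((1# + - x) ^ (1 ℕ.+ r)) (P k ^ (2 ℕ.+ r)) x (P (1 ℕ.+ j)) (G (1 ℕ.+ r)) ⟩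
        x * x * P (1 ℕ.+ j) * ((1# + - x) ^ (1 ℕ.+ r) * P k ^ (2 ℕ.+ r) * G (1 ℕ.+ r))
          ≈⟨ *-congˡ (G-suc r) ⟩
        x * x * P (1 ℕ.+ j) * (x ^ (2 ℕ.* r ℕ.+ k) * P (1 ℕ.+ j) ^ r)
          ≈⟨ solve 4 (λ x p y z → x :* x :* p :* (y :* z) := x :* (x :* y) :* (p :* z))
               refl x (P (1 ℕ.+ j)) (x ^ (2 ℕ.* r ℕ.+ k)) (P (1 ℕ.+ j) ^ r) ⟩
        x ^ (2 ℕ.+ (2 ℕ.* r ℕ.+ k)) * P (1 ℕ.+ j) ^ (1 ℕ.+ r)
          ≡⟨ ≡.cong (λ i → x ^ (i ℕ.+ k) * P (1 ℕ.+ j) ^ (1 ℕ.+ r)) (≡.sym (ℕ.*-suc 2 r)) ⟩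
        x ^ (2 ℕ.* suc r ℕ.+ k) * P (1 ℕ.+ j) ^ (1 ℕ.+ r) ∎

-- Extracting coefficients of powers of q

module 𝔹 = PowerSeries ℚ.+-*-commutativeRing
module 𝔸 = PowerSeries 𝔹.commutativeRing
module BR = CommutativeRing 𝔹.commutativeRing
module AR = CommutativeRing 𝔸.commutativeRing
module T = TreeSeries 𝔹.commutativeRing 𝔹.X
module CA = ContinuedFraction 𝔸.commutativeRing 𝔸.X
module CB = ContinuedFraction 𝔹.commutativeRing 𝔹.X
module BExp = Exp BR.commutativeSemiring

open 𝔹 using (_≐_; at; coefficientwise)

-- 𝔹 serves both as ℚ[[x]] and as ℚ[[q]]; 𝔸 is ℚ[[q]][[x]].
q-coef : ℕ → (ℕ → Series) → Series
q-coef r h n = h n r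

q-coef-cong : ∀ r {g h} → g 𝔸.≐ h → q-coef r g ≐ q-coef r h
q-coef-cong r p = coefficientwise λ n → at (𝔸.at p n) r

q-coef-X : ∀ r h → q-coef r (𝔸.X 𝔸.⊛ h) ≐ 𝔹.X 𝔹.⊛ q-coef r h
q-coef-X r h = coefficientwise λ where
  zero    → ≡.trans (at (𝔸.X-⊛-zero h) r) (≡.trans (𝔹.const-0 r) (≡.sym (𝔹.X-⊛-zero (q-coef r h))))
  (suc n) → ≡.trans (at (𝔸.X-⊛-suc h n) r) (≡.sym (𝔹.X-⊛-suc (q-coef r h) n))

q-coef--X : ∀ r h → q-coef r ((𝔸.⊝ 𝔸.X) 𝔸.⊛ h) ≐ (𝔹.⊝ 𝔹.X) 𝔹.⊛ q-coef r h
q-coef--X r h = coefficientwise λ n → ≡.trans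
  (≡.sym (at (𝔸.at (RingProperties.-‿distribˡ-* AR.ring 𝔸.X h) n) r))
  (≡.trans (≡.cong ℚ.-_ (at (q-coef-X r h) n))
    (at (RingProperties.-‿distribˡ-* BR.ring 𝔹.X (q-coef r h)) n))

-- Taking a coefficient of q is additive but not multiplicative. It does commute with `P j`, which
-- is built from x without q.
q-coef-P : ∀ j r h → q-coef r (CA.P j 𝔸.⊛ h) ≐ CB.P j 𝔹.⊛ q-coef r h
q-coef-P zero          r h =
  BR.trans (q-coef-cong r (AR.*-identityˡ h)) (BR.sym (BR.*-identityˡ (q-coef r h)))
q-coef-P (suc zero)    r h = q-coef-P zero r h
q-coef-P (suc (suc j)) r h = BR.trans
  (q-coef-cong r (AR.trans (AR.distribʳ h (CA.P (suc j)) ((𝔸.⊝ 𝔸.X) 𝔸.⊛ CA.P j))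
    (AR.+-congˡ {CA.P (suc j) 𝔸.⊛ h} (AR.*-assoc (𝔸.⊝ 𝔸.X) (CA.P j) h))))
  (BR.trans
    (BR.+-cong (q-coef-P (suc j) r h)
      (BR.trans (q-coef--X r (CA.P j 𝔸.⊛ h)) (BR.*-congˡ {𝔹.⊝ 𝔹.X} (q-coef-P j r h))))
    (BR.sym (BR.trans (BR.distribʳ (q-coef r h) (CB.P (suc j)) ((𝔹.⊝ 𝔹.X) 𝔹.⊛ CB.P j))
      (BR.+-congˡ {CB.P (suc j) 𝔹.⊛ q-coef r h} (BR.*-assoc (𝔹.⊝ 𝔹.X) (CB.P j) (q-coef r h))))))

q-coef-q-zero : ∀ h → q-coef 0 (𝔸.const 𝔹.X 𝔸.⊛ h) ≐ BR.0#
q-coef-q-zero h = coefficientwise λ n → ≡.trans (at (𝔸.const-⊛ 𝔹.X h n) 0)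
  (≡.trans (𝔹.X-⊛-zero (h n)) (≡.sym (𝔹.const-0 n)))

q-coef-q-suc : ∀ r h → q-coef (suc r) (𝔸.const 𝔹.X 𝔸.⊛ h) ≐ q-coef r h
q-coef-q-suc r h = coefficientwise λ n → ≡.trans (at (𝔸.const-⊛ 𝔹.X h n) (suc r)) (𝔹.X-⊛-suc (h n) r)

q-coef-1-zero : q-coef 0 AR.1# ≐ BR.1#
q-coef-1-zero = coefficientwise λ { zero → ≡.refl ; (suc _) → ≡.refl }

q-coef-1-suc : ∀ r → q-coef (suc r) AR.1# ≐ BR.0#
q-coef-1-suc r = coefficientwise λ { zero → ≡.refl ; (suc _) → ≡.refl }

q-coef-trailing : ∀ j r h → q-coef r ((𝔸.⊝ 𝔸.X) 𝔸.⊛ (𝔸.X 𝔸.⊛ (CA.P j 𝔸.⊛ h))) ≐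
                    (𝔹.⊝ 𝔹.X) 𝔹.⊛ (𝔹.X 𝔹.⊛ (CB.P j 𝔹.⊛ q-coef r h))
q-coef-trailing j r h = BR.trans (q-coef--X r (𝔸.X 𝔸.⊛ (CA.P j 𝔸.⊛ h))) (BR.*-congˡ {𝔹.⊝ 𝔹.X}
  (BR.trans (q-coef-X r (CA.P j 𝔸.⊛ h)) (BR.*-congˡ {𝔹.X} (q-coef-P j r h))))

-- ((1 - x) P_i - q x² P_j) h, written so that its part free of q becomes `leading` and the rest,
-- with q shifted away, becomes `trailing`.
convergent : ℕ → ℕ → (ℕ → Series) → ℕ → Series
convergent i j h = CA.P i 𝔸.⊛ h 𝔸.⊕ (𝔸.⊝ 𝔸.X) 𝔸.⊛ (CA.P i 𝔸.⊛ h) 𝔸.⊕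
            𝔸.const 𝔹.X 𝔸.⊛ ((𝔸.⊝ 𝔸.X) 𝔸.⊛ (𝔸.X 𝔸.⊛ (CA.P j 𝔸.⊛ h)))

leading : ℕ → Series → Series
leading i g = CB.P i 𝔹.⊛ g 𝔹.⊕ (𝔹.⊝ 𝔹.X) 𝔹.⊛ (CB.P i 𝔹.⊛ g)

trailing : ℕ → Series → Series
trailing j g = (𝔹.⊝ 𝔹.X) 𝔹.⊛ (𝔹.X 𝔹.⊛ (CB.P j 𝔹.⊛ g))

q-coef-leading : ∀ i r h →
  q-coef r (CA.P i 𝔸.⊛ h 𝔸.⊕ (𝔸.⊝ 𝔸.X) 𝔸.⊛ (CA.P i 𝔸.⊛ h)) ≐ leading i (q-coef r h)
q-coef-leading i r h = BR.+-cong (q-coef-P i r h)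
  (BR.trans (q-coef--X r (CA.P i 𝔸.⊛ h)) (BR.*-congˡ {𝔹.⊝ 𝔹.X} (q-coef-P i r h)))

q-coef-convergent-zero : ∀ i j h →
  q-coef 0 (convergent i j h) ≐ leading i (q-coef 0 h)
q-coef-convergent-zero i j h = BR.trans
  (BR.+-cong (q-coef-leading i 0 h)
    (q-coef-q-zero ((𝔸.⊝ 𝔸.X) 𝔸.⊛ (𝔸.X 𝔸.⊛ (CA.P j 𝔸.⊛ h)))))
  (BR.+-identityʳ (leading i (q-coef 0 h)))

q-coef-convergent-suc : ∀ i j r h →
  q-coef (suc r) (convergent i j h) ≐ leading i (q-coef (suc r) h) 𝔹.⊕ trailing j (q-coef r h)
q-coef-convergent-suc i j r h = BR.+-cong (q-coef-leading i (suc r) h)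
  (BR.trans (q-coef-q-suc r ((𝔸.⊝ 𝔸.X) 𝔸.⊛ (𝔸.X 𝔸.⊛ (CA.P j 𝔸.⊛ h))))
    (q-coef-trailing j r h))

open 𝔹 using (X; _⊛_; _⊕_; ⊝_)
open BExp using (_^_; ^-homo-*)

-- Counts of trees as coefficients of `H`

fromℕ-suc : ∀ n → 1ℚ ℚ.+ (ℤ.+ n ℚ./ 1) ≡ ℤ.+ suc n ℚ./ 1
fromℕ-suc n = ℚ.toℚᵘ-injective (begin
  -- `_/_` reduces by a gcd, so the sum is compared on unreduced fractions with denominator 1.
  ℚ.toℚᵘ (1ℚ ℚ.+ (ℤ.+ n ℚ./ 1))        ≈⟨ ℚ.toℚᵘ-homo-+ 1ℚ (ℤ.+ n ℚ./ 1) ⟩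
  ℚᵘ.1ℚᵘ ℚᵘ.+ ℚ.toℚᵘ (ℤ.+ n ℚ./ 1)     ≈⟨ ℚᵘ.+-congʳ ℚᵘ.1ℚᵘ (ℚ.toℚᵘ-fromℚᵘ (ℚᵘ.mkℚᵘ (ℤ.+ n) 0)) ⟩
  ℚᵘ.1ℚᵘ ℚᵘ.+ ℚᵘ.mkℚᵘ (ℤ.+ n) 0        ≡⟨ ≡.cong (λ m → ℚᵘ.mkℚᵘ (ℤ.+ 1 ℤ.+ m) 0) (ℤ.*-identityʳ (ℤ.+ n)) ⟩
  ℚᵘ.mkℚᵘ (ℤ.+ suc n) 0                ≈⟨ ℚ.toℚᵘ-fromℚᵘ (ℚᵘ.mkℚᵘ (ℤ.+ suc n) 0) ⟨
  ℚ.toℚᵘ (ℤ.+ suc n ℚ./ 1)             ∎)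
  where open ℚᵘ.≃-Reasoning

X^-coefficient : ∀ m → (𝔹.X ^ m) m ≡ 1ℚ
X^-coefficient zero    = ≡.refl
X^-coefficient (suc m) = ≡.trans (𝔹.X-⊛-suc (𝔹.X ^ m) m) (X^-coefficient m)

X^-coefficient-≢ : ∀ m r → m ≢ r → (𝔹.X ^ m) r ≡ 0ℚ
X^-coefficient-≢ zero    zero    m≢r = ⊥-elim (m≢r ≡.refl)
X^-coefficient-≢ zero    (suc r) m≢r = ≡.refl
X^-coefficient-≢ (suc m) zero    m≢r = 𝔹.X-⊛-zero (𝔹.X ^ m)
X^-coefficient-≢ (suc m) (suc r) m≢r =
  ≡.trans (𝔹.X-⊛-suc (𝔹.X ^ m) r) (X^-coefficient-≢ m r (m≢r ∘ ≡.cong suc))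

-- The weight is cut off only if `c (suc j) t` is positive, and then `c j t` exceeds `j`.
weight-coefficient-≡ : ∀ j t → c j t ≤ j → T.weight j t (c j t) ≡ 1ℚ
weight-coefficient-≡ j t c≤j with c (suc j) t | c-suc-positive j t
... | zero  | _        = X^-coefficient (c j t)
... | suc _ | positive = ⊥-elim (ℕ.<-irrefl ≡.refl (ℕ.≤-trans (positive (ℕ.s≤s ℕ.z≤n)) c≤j))

weight-coefficient-≢ : ∀ j t r → c j t ≢ r → T.weight j t r ≡ 0ℚ
weight-coefficient-≢ j t r c≢r with c (suc j) t
... | zero  = X^-coefficient-≢ (c j t) r c≢r
... | suc _ with r
...   | zero  = ≡.refl
...   | suc _ = ≡.refl

count-total : ∀ j r → r ≤ j → ∀ ts → ℤ.+ count (λ t → c j t ℕ.≟ r) ts ℚ./ 1 ≡ T.total (T.weight j) ts r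
count-total j r r≤j []       with r
... | zero  = ≡.refl
... | suc _ = ≡.refl
count-total j r r≤j (t ∷ ts) = step (c j t ℕ.≟ r)
  where
  has-r? = λ t → c j t ℕ.≟ r
  step : Dec (c j t ≡ r) → ℤ.+ count has-r? (t ∷ ts) ℚ./ 1 ≡ T.total (T.weight j) (t ∷ ts) r
  step (yes eq) = ≡.trans (≡.cong (λ us → ℤ.+ List.length us ℚ./ 1) (filter-accept has-r? eq))
    (≡.trans (≡.sym (fromℕ-suc (count has-r? ts)))
    (≡.cong₂ ℚ._+_
      (≡.sym (≡.trans (≡.cong (T.weight j t) (≡.sym eq))
        (weight-coefficient-≡ j t (≡.subst (_≤ j) (≡.sym eq) r≤j))))
      (count-total j r r≤j ts)))
  step (no c≢r) = ≡.trans (≡.cong (λ us → ℤ.+ List.length us ℚ./ 1) (filter-reject has-r? c≢r))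
    (≡.trans (≡.sym (ℚ.+-identityˡ (ℤ.+ count has-r? ts ℚ./ 1)))
    (≡.cong₂ ℚ._+_ (≡.sym (weight-coefficient-≢ j t r c≢r)) (count-total j r r≤j ts)))

F-coefficient : ∀ {k} (τ : GenPattern k) r n {m} → f τ r n ≡ m → F τ r n ≡ ℤ.+ m ℚ./ 1
F-coefficient τ r n eq = ≡.cong (λ m → ℤ.+ m ℚ./ 1) eq

-- The index of `c` is one below the length of the pattern, hence `H (2 + j)` for length `3 + j`.
F≐q-coef : ∀ j r → r ≤ suc j → F (12-3-⋯-k (suc (suc (suc j)))) r ≐ q-coef r (T.H (2 ℕ.+ j))
F≐q-coef j r r≤j = coefficientwise λ n → ≡.trans
  (F-coefficient (12-3-⋯-k (suc (suc (suc j)))) r n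
    {count (λ t → c (2 ℕ.+ j) t ℕ.≟ r) (trees n)} (f≡count-trees (suc j) r n))
  (count-total (2 ℕ.+ j) r (ℕ.≤-trans r≤j (ℕ.n≤1+n _)) (trees n))

-- The recursion for the coefficients of `H`

q-coef-H-equation : ∀ j r →
  q-coef r (convergent (3 ℕ.+ j) (1 ℕ.+ j) (T.H (2 ℕ.+ j))) ≐ q-coef r (convergent (2 ℕ.+ j) j AR.1#)
q-coef-H-equation j r = q-coef-cong r
  (CA.H-equation {Q = 𝔸.const 𝔹.X} {Z = T.Z} {H = T.H} T.Z-equation T.H-zero T.H-suc j)

leading-cong : ∀ i {g h} → g ≐ h → leading i g ≐ leading i h
leading-cong i {g} {h} p = BR.+-cong q (BR.*-congˡ {𝔹.⊝ 𝔹.X} q)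
  where
  q : CB.P i 𝔹.⊛ g ≐ CB.P i 𝔹.⊛ h
  q = BR.*-congˡ {CB.P i} p

leading-1 : ∀ i → leading i BR.1# ≐ CB.P i 𝔹.⊕ (𝔹.⊝ 𝔹.X) 𝔹.⊛ CB.P i
leading-1 i = BR.+-cong q (BR.*-congˡ {𝔹.⊝ 𝔹.X} q)
  where
  q : CB.P i 𝔹.⊛ BR.1# ≐ CB.P i
  q = BR.*-identityʳ (CB.P i)

leading-0 : ∀ i → leading i BR.0# ≐ BR.0#
leading-0 i = BR.trans (BR.+-cong q (BR.trans (BR.*-congˡ {𝔹.⊝ 𝔹.X} q) (BR.zeroʳ (𝔹.⊝ 𝔹.X))))
  (BR.+-identityˡ BR.0#)
  where
  q : CB.P i 𝔹.⊛ BR.0# ≐ BR.0#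
  q = BR.zeroʳ (CB.P i)

trailing-cong : ∀ i {g h} → g ≐ h → trailing i g ≐ trailing i h
trailing-cong i p = BR.*-congˡ {𝔹.⊝ 𝔹.X} (BR.*-congˡ {𝔹.X} (BR.*-congˡ {CB.P i} p))

trailing-1 : ∀ i → trailing i BR.1# ≐ (𝔹.⊝ 𝔹.X) 𝔹.⊛ (𝔹.X 𝔹.⊛ CB.P i)
trailing-1 i = BR.*-congˡ {𝔹.⊝ 𝔹.X} (BR.*-congˡ {𝔹.X} (BR.*-identityʳ (CB.P i)))

trailing-0 : ∀ i → trailing i BR.0# ≐ BR.0#
trailing-0 i = BR.trans
  (BR.*-congˡ {𝔹.⊝ 𝔹.X} (BR.trans (BR.*-congˡ {𝔹.X} (BR.zeroʳ (CB.P i))) (BR.zeroʳ 𝔹.X)))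
  (BR.zeroʳ (𝔹.⊝ 𝔹.X))

module _ (j : ℕ) where

  private
    k = 3 ℕ.+ j

    G : ℕ → Series
    G r = q-coef r (T.H (2 ℕ.+ j))

    e₀ : leading k (G 0) ≐ CB.P (2 ℕ.+ j) 𝔹.⊕ (𝔹.⊝ 𝔹.X) 𝔹.⊛ CB.P (2 ℕ.+ j)
    e₀ = BR.trans (BR.sym (q-coef-convergent-zero k (1 ℕ.+ j) (T.H (2 ℕ.+ j))))
      (BR.trans (q-coef-H-equation j 0) (BR.trans (q-coef-convergent-zero (2 ℕ.+ j) j AR.1#)
      (BR.trans (leading-cong (2 ℕ.+ j) q-coef-1-zero) (leading-1 (2 ℕ.+ j)))))

    -- The series 1 has no positive powers of q, so its leading part vanishes here. Its trailing
    -- part sits one power of q higher and survives for r = 0 only, which separates `e₁` from `e₂`.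
    e-suc : ∀ r → leading k (G (suc r)) 𝔹.⊕ trailing (1 ℕ.+ j) (G r) ≐ trailing j (q-coef r AR.1#)
    e-suc r = BR.trans (BR.sym (q-coef-convergent-suc k (1 ℕ.+ j) r (T.H (2 ℕ.+ j))))
      (BR.trans (q-coef-H-equation j (suc r))
      (BR.trans (q-coef-convergent-suc (2 ℕ.+ j) j r AR.1#)
      (BR.trans (BR.+-congʳ {trailing j (q-coef r AR.1#)}
          (BR.trans (leading-cong (2 ℕ.+ j) (q-coef-1-suc r)) (leading-0 (2 ℕ.+ j))))
        (BR.+-identityˡ (trailing j (q-coef r AR.1#))))))

    -- Counting the trees without rises over ℚ instead of ℚ[[q]] supplies the inverse of 1 - x in
    -- ℚ[[x]].
    Z-equation : TreeSeries.Z ℚ.+-*-commutativeRing 0ℚ ≐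
      BR.1# 𝔹.⊕ 𝔹.X 𝔹.⊛ TreeSeries.Z ℚ.+-*-commutativeRing 0ℚ
    Z-equation = TreeSeries.Z-equation ℚ.+-*-commutativeRing 0ℚ

    e₁ : leading k (G 1) 𝔹.⊕ trailing (1 ℕ.+ j) (G 0) ≐ (𝔹.⊝ 𝔹.X) 𝔹.⊛ (𝔹.X 𝔹.⊛ CB.P j)
    e₁ = BR.trans (e-suc 0) (BR.trans (trailing-cong j q-coef-1-zero) (trailing-1 j))

    e₂ : ∀ r → leading k (G (2 ℕ.+ r)) 𝔹.⊕ trailing (1 ℕ.+ j) (G (1 ℕ.+ r)) ≐ BR.0#
    e₂ r = BR.trans (e-suc (suc r)) (BR.trans (trailing-cong j (q-coef-1-suc r)) (trailing-0 j))

    open ClosedForm 𝔹.commutativeRing 𝔹.X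

  closed-zero : ∀ {g} → g ≐ G 0 → CB.P k 𝔹.⊛ g ≐ CB.P (2 ℕ.+ j)
  closed-zero p = BR.trans (BR.*-congˡ {CB.P k} p) (G-zero Z-equation j {G} e₀ e₁ e₂)

  closed-suc : ∀ {g} r → g ≐ G (1 ℕ.+ r) →
    (BR.1# 𝔹.⊕ 𝔹.⊝ 𝔹.X) ^ (1 ℕ.+ r) 𝔹.⊛ CB.P k ^ (2 ℕ.+ r) 𝔹.⊛ g ≐
    𝔹.X ^ (2 ℕ.* r ℕ.+ k) 𝔹.⊛ CB.P (1 ℕ.+ j) ^ r
  closed-suc r p = BR.trans
    (BR.*-congˡ {(BR.1# 𝔹.⊕ 𝔹.⊝ 𝔹.X) ^ (1 ℕ.+ r) 𝔹.⊛ CB.P k ^ (2 ℕ.+ r)} p)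
    (G-suc Z-equation j {G} e₀ e₁ e₂ r)

-- Polynomials

polynomial-1 : IsPolynomial BR.1#
polynomial-1 = 0 , λ { (suc _) _ → ≡.refl }

polynomial-X : IsPolynomial X
polynomial-X = 1 , λ { (suc (suc _)) _ → ≡.refl ; (suc zero) (s≤s ()) }

polynomial-⊕ : ∀ {a b} → IsPolynomial a → IsPolynomial b → IsPolynomial (a ⊕ b)
polynomial-⊕ (d , p) (e , q) = d ℕ.+ e , λ n d+e<n → ≡.trans
  (≡.cong₂ ℚ._+_ (p n (ℕ.≤-<-trans (ℕ.m≤m+n d e) d+e<n)) (q n (ℕ.≤-<-trans (ℕ.m≤n+m e d) d+e<n)))
  (ℚ.+-identityˡ 0ℚ)

polynomial-⊝ : ∀ {a} → IsPolynomial a → IsPolynomial (⊝ a)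
polynomial-⊝ (d , p) = d , λ n d<n → ≡.cong ℚ.-_ (p n d<n)

polynomial-⊛ : ∀ {a b} → IsPolynomial a → IsPolynomial b → IsPolynomial (a ⊛ b)
polynomial-⊛ {a} {b} (d , p) (e , q) = d ℕ.+ e , vanishes d a p
  where
  vanishes : ∀ d a → (∀ n → d < n → a n ≡ 0ℚ) → ∀ n → d ℕ.+ e < n → (a ⊛ b) n ≡ 0ℚ
  vanishes d a p (suc n) d+e<n = ≡.trans
    (≡.cong₂ ℚ._+_ (≡.trans (≡.cong (a 0 ℚ.*_) (q (suc n) (ℕ.≤-<-trans (ℕ.m≤n+m e d) d+e<n)))
                      (ℚ.*-zeroʳ (a 0)))
                    (rest d p d+e<n))
    (ℚ.+-identityˡ 0ℚ)
    where
    -- Passing to the tail of `a` lowers its degree bound by one; at bound 0 the tail is the zero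
    -- series.
    rest : ∀ d → (∀ n → d < n → a n ≡ 0ℚ) → d ℕ.+ e < suc n → ((a ∘ suc) ⊛ b) n ≡ 0ℚ
    rest zero    p _     = ≡.trans
      (𝔹.⊛-cong {b = b} (λ m → p (suc m) (s≤s z≤n)) (λ _ → ≡.refl) n)
      (𝔹.⊛-zeroˡ b n)
    rest (suc d) p d+e<n = vanishes d (a ∘ suc) (λ m d<m → p (suc m) (s≤s d<m)) n (s≤s⁻¹ d+e<n)

polynomial-^ : ∀ {a} → IsPolynomial a → ∀ n → IsPolynomial (a ^ n)
polynomial-^ p zero    = polynomial-1
polynomial-^ {a} p (suc n) = polynomial-⊛ {a} {a ^ n} p (polynomial-^ p n)

polynomial-P : ∀ j → IsPolynomial (CB.P j)
polynomial-P zero          = polynomial-1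
polynomial-P (suc zero)    = polynomial-1
polynomial-P (suc (suc j)) = polynomial-⊕ {CB.P (suc j)} {(⊝ X) ⊛ CB.P j} (polynomial-P (suc j))
  (polynomial-⊛ {⊝ X} {CB.P j} (polynomial-⊝ {X} polynomial-X) (polynomial-P j))

-- Constant terms

⊛-constant : ∀ {a b} → a 0 ≡ 1ℚ → b 0 ≡ 1ℚ → (a ⊛ b) 0 ≡ 1ℚ
⊛-constant p q = ≡.cong₂ (λ u v → u ℚ.* v ℚ.+ 0ℚ) p q

^-constant : ∀ {a} n → a 0 ≡ 1ℚ → (a ^ n) 0 ≡ 1ℚ
^-constant zero    p = ≡.refl
^-constant {a} (suc n) p = ⊛-constant {a} {a ^ n} p (^-constant n p)

P-constant : ∀ j → CB.P j 0 ≡ 1ℚ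
P-constant zero          = ≡.refl
P-constant (suc zero)    = ≡.refl
P-constant (suc (suc j)) =
  ≡.cong₂ (λ u v → u ℚ.+ ((ℚ.- 0ℚ) ℚ.* v ℚ.+ 0ℚ)) (P-constant (suc j)) (P-constant j)

1≢0 : 1ℚ ≢ 0ℚ
1≢0 ()

rational : ∀ {g} p q → IsPolynomial p → IsPolynomial q → q 0 ≡ 1ℚ → q ⊛ g ≐ p → IsRational g
rational {g} p q p-poly q-poly q₀ eq = p , q , p-poly , q-poly ,
  (λ q≋0 → 1≢0 (≡.trans (≡.sym q₀) (q≋0 0))) ,
  at (BR.trans (BR.*-comm g q) eq)

-- Substitution x = s²

in-s²-cong : ∀ {a b} → (∀ n → a n ≡ b n) → ∀ n → in-s² a n ≡ in-s² b n
in-s²-cong p zero          = p 0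
in-s²-cong p (suc zero)    = ≡.refl
in-s²-cong p (suc (suc n)) = in-s²-cong (p ∘ suc) n

in-s²-⊕ : ∀ a b n → in-s² (a ⊕ b) n ≡ in-s² a n ℚ.+ in-s² b n
in-s²-⊕ a b zero          = ≡.refl
in-s²-⊕ a b (suc zero)    = ≡.sym (ℚ.+-identityˡ 0ℚ)
in-s²-⊕ a b (suc (suc n)) = in-s²-⊕ (a ∘ suc) (b ∘ suc) n

in-s²-⊝ : ∀ a n → in-s² (⊝ a) n ≡ ℚ.- in-s² a n
in-s²-⊝ a zero          = ≡.refl
in-s²-⊝ a (suc zero)    = ≡.refl
in-s²-⊝ a (suc (suc n)) = in-s²-⊝ (a ∘ suc) n

in-s²-scale : ∀ u a n → in-s² (λ m → u ℚ.* a m) n ≡ u ℚ.* in-s² a n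
in-s²-scale u a zero          = ≡.refl
in-s²-scale u a (suc zero)    = ≡.sym (ℚ.*-zeroʳ u)
in-s²-scale u a (suc (suc n)) = in-s²-scale u (a ∘ suc) n

in-s²-⊛ : ∀ a b n → in-s² (a ⊛ b) n ≡ (in-s² a ⊛ in-s² b) n
in-s²-⊛ a b zero          = ≡.refl
in-s²-⊛ a b (suc zero)    =
  ≡.sym (≡.cong₂ (λ u v → u ℚ.+ (v ℚ.+ 0ℚ)) (ℚ.*-zeroʳ (a 0)) (ℚ.*-zeroˡ (b 0)))
in-s²-⊛ a b (suc (suc n)) = begin
  in-s² ((λ m → a 0 ℚ.* b (suc m)) ⊕ ((a ∘ suc) ⊛ b)) n
    ≡⟨ in-s²-⊕ (λ m → a 0 ℚ.* b (suc m)) ((a ∘ suc) ⊛ b) n ⟩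
  in-s² (λ m → a 0 ℚ.* b (suc m)) n ℚ.+ in-s² ((a ∘ suc) ⊛ b) n
    ≡⟨ ≡.cong₂ ℚ._+_ (in-s²-scale (a 0) (b ∘ suc) n) (in-s²-⊛ (a ∘ suc) b n) ⟩
  a 0 ℚ.* in-s² (b ∘ suc) n ℚ.+ (in-s² (a ∘ suc) ⊛ in-s² b) n
    -- The coefficient of s in `in-s² a` is 0; its term is put back to match the convolution
    -- unfolded twice.
    ≡⟨ ≡.cong (a 0 ℚ.* in-s² (b ∘ suc) n ℚ.+_) (≡.trans
         (≡.cong (ℚ._+ (in-s² (a ∘ suc) ⊛ in-s² b) n) (ℚ.*-zeroˡ (in-s² b (suc n)))) (ℚ.+-identityˡ _)) ⟨
  a 0 ℚ.* in-s² (b ∘ suc) n ℚ.+ (0ℚ ℚ.* in-s² b (suc n) ℚ.+ (in-s² (a ∘ suc) ⊛ in-s² b) n) ∎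
  where open ≡.≡-Reasoning

in-s²-1 : in-s² BR.1# ≐ BR.1#
in-s²-1 = coefficientwise λ { zero → ≡.refl ; (suc zero) → ≡.refl ; (suc (suc n)) → zeros n }
  where
  zeros : ∀ n → in-s² (λ _ → 0ℚ) n ≡ 0ℚ
  zeros zero          = ≡.refl
  zeros (suc zero)    = ≡.refl
  zeros (suc (suc n)) = zeros n

-- On the left `X` is the variable x, on the right it is s.
in-s²-X : in-s² X ≐ X ⊛ X
in-s²-X = coefficientwise λ where
  zero          → ≡.refl
  (suc zero)    → ≡.sym (𝔹.X-⊛-suc X 0)
  (suc (suc n)) → ≡.trans (in-s²-cong 𝔹.X∘suc n)
    (≡.trans (at in-s²-1 n) (≡.sym (≡.trans (𝔹.X-⊛-suc X (suc n)) (𝔹.X∘suc n))))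

shift≐ : ∀ d a → shift d a ≐ X ^ d ⊛ a
shift≐ zero    a = BR.sym (BR.*-identityˡ a)
shift≐ (suc d) a = coefficientwise λ where
  zero    → ≡.sym (≡.trans (at (BR.*-assoc X (X ^ d) a) 0) (𝔹.X-⊛-zero (X ^ d ⊛ a)))
  (suc n) → ≡.trans (at (shift≐ d a) n)
    (≡.sym (≡.trans (at (BR.*-assoc X (X ^ d) a) (suc n)) (𝔹.X-⊛-suc (X ^ d ⊛ a) n)))

X^-cancel : ∀ d {a b} → X ^ d ⊛ a ≐ X ^ d ⊛ b → a ≐ b
X^-cancel d {a} {b} p = coefficientwise
  (shift-cancel d (at (BR.trans (shift≐ d a) (BR.trans p (BR.sym (shift≐ d b))))))
  where
  shift-cancel : ∀ d → (∀ n → shift d a n ≡ shift d b n) → ∀ n → a n ≡ b n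
  shift-cancel zero    p = p
  shift-cancel (suc d) p = shift-cancel d (p ∘ suc)

-- Laurent series

infix 4 _∼_
-- The equality of Laurent series with `shift` replaced by multiplication by a power of s, which is
-- `X` here, so that ring identities apply.
record _∼_ (A B : Laurent) : Set where
  constructor mk∼
  open Laurent
  field cross : X ^ pole B ⊛ coef A ≐ X ^ pole A ⊛ coef B
open _∼_

∼⇒≈ : ∀ {A B} → A ∼ B → A L.≈ B
∼⇒≈ {s^- d · a} {s^- e · b} (mk∼ p) = at (BR.trans (shift≐ e a) (BR.trans p (BR.sym (shift≐ d b))))

≈⇒∼ : ∀ {A B} → A L.≈ B → A ∼ B
≈⇒∼ {s^- d · a} {s^- e · b} p =
  mk∼ (BR.trans (BR.sym (shift≐ e a)) (BR.trans (coefficientwise p) (shift≐ d b)))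

-- v * a ≈ u * b stands for a / u = b / v.
module Fractions {κ ℓ} (B : CommutativeRing κ ℓ) where
  open CommutativeRing B hiding (zero)
  open NatSolver commutativeSemiring using (solve; _:+_; _:*_; _:=_; con)
  open SetoidReasoning setoid

  cross-trans : ∀ {u v w a b c} → v * a ≈ u * b → w * b ≈ v * c → v * (w * a) ≈ v * (u * c)
  cross-trans {u} {v} {w} {a} {b} {c} p q = begin
    v * (w * a)  ≈⟨ solve 3 (λ v w a → v :* (w :* a) := w :* (v :* a)) refl v w a ⟩
    w * (v * a)  ≈⟨ *-congˡ p ⟩
    w * (u * b)  ≈⟨ solve 3 (λ u w b → w :* (u :* b) := u :* (w :* b)) refl u w b ⟩
    u * (w * b)  ≈⟨ *-congˡ q ⟩
    u * (v * c)  ≈⟨ solve 3 (λ u v c → u :* (v :* c) := v :* (u :* c)) refl u v c ⟩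
    v * (u * c)  ∎

  cross-* : ∀ {u v a b u′ v′ a′ b′} → v * a ≈ u * b → v′ * a′ ≈ u′ * b′ →
    (v * v′) * (a * a′) ≈ (u * u′) * (b * b′)
  cross-* {u} {v} {a} {b} {u′} {v′} {a′} {b′} p q = begin
    (v * v′) * (a * a′)  ≈⟨ shuffle v v′ a a′ ⟩
    (v * a) * (v′ * a′)  ≈⟨ *-cong p q ⟩
    (u * b) * (u′ * b′)  ≈⟨ shuffle u u′ b b′ ⟨
    (u * u′) * (b * b′)  ∎
    where
    shuffle : ∀ v v′ a a′ → (v * v′) * (a * a′) ≈ (v * a) * (v′ * a′)
    shuffle = solve 4 (λ v v′ a a′ → (v :* v′) :* (a :* a′) := (v :* a) :* (v′ :* a′)) refl

  cross-+ : ∀ {u v a b u′ v′ a′ b′} → v * a ≈ u * b → v′ * a′ ≈ u′ * b′ →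
    (v * v′) * (u′ * a + u * a′) ≈ (u * u′) * (v′ * b + v * b′)
  cross-+ {u} {v} {a} {b} {u′} {v′} {a′} {b′} p q = begin
    (v * v′) * (u′ * a + u * a′)
      ≈⟨ solve 6 (λ u v a u′ v′ a′ → (v :* v′) :* (u′ :* a :+ u :* a′) :=
           (v′ :* u′) :* (v :* a) :+ (v :* u) :* (v′ :* a′)) refl u v a u′ v′ a′ ⟩
    (v′ * u′) * (v * a) + (v * u) * (v′ * a′)
      ≈⟨ +-cong (*-congˡ p) (*-congˡ q) ⟩
    (v′ * u′) * (u * b) + (v * u) * (u′ * b′)
      ≈⟨ solve 6 (λ u v b u′ v′ b′ → (v′ :* u′) :* (u :* b) :+ (v :* u) :* (u′ :* b′) :=
           (u :* u′) :* (v′ :* b :+ v :* b′)) refl u v b u′ v′ b′ ⟩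
    (u * u′) * (v′ * b + v * b′) ∎

module FB = Fractions 𝔹.commutativeRing

∼-refl : ∀ {A} → A ∼ A
∼-refl = mk∼ BR.refl

∼-sym : ∀ {A B} → A ∼ B → B ∼ A
∼-sym (mk∼ p) = mk∼ (BR.sym p)

∼-trans : ∀ {A B C} → A ∼ B → B ∼ C → A ∼ C
∼-trans {s^- d · a} {s^- e · b} {s^- f · c} (mk∼ p) (mk∼ q) =
  -- Chaining the two cross-multiplied equations leaves a common factor s^e.
  mk∼ (X^-cancel e (FB.cross-trans {X ^ d} {X ^ e} {X ^ f} {a} {b} {c} p q))

∼-* : ∀ {A B A′ B′} → A ∼ B → A′ ∼ B′ → A L.* A′ ∼ B L.* B′
∼-* {s^- d · a} {s^- e · b} {s^- d′ · a′} {s^- e′ · b′} (mk∼ p) (mk∼ q) = mk∼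
  (BR.trans (BR.*-congʳ {a ⊛ a′} (^-homo-* X e e′))
  (BR.trans (FB.cross-* {X ^ d} {X ^ e} {a} {b} {X ^ d′} {X ^ e′} {a′} {b′} p q)
    (BR.sym (BR.*-congʳ {b ⊛ b′} (^-homo-* X d d′)))))

∼-+ : ∀ {A B A′ B′} → A ∼ B → A′ ∼ B′ → A L.+ A′ ∼ B L.+ B′
∼-+ {s^- d · a} {s^- e · b} {s^- d′ · a′} {s^- e′ · b′} (mk∼ p) (mk∼ q) = mk∼
  (BR.trans (BR.*-cong (^-homo-* X e e′) (BR.+-cong (shift≐ d′ a) (shift≐ d a′)))
  (BR.trans (FB.cross-+ {X ^ d} {X ^ e} {a} {b} {X ^ d′} {X ^ e′} {a′} {b′} p q)
    (BR.sym (BR.*-cong (^-homo-* X d d′) (BR.+-cong (shift≐ e′ b) (shift≐ e b′))))))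

∼-neg : ∀ {A B} → A ∼ B → L.- A ∼ L.- B
∼-neg {s^- d · a} {s^- e · b} (mk∼ p) = mk∼
  (BR.trans (BR.sym (RingProperties.-‿distribʳ-* BR.ring (X ^ e) a))
  (BR.trans (BR.-‿cong p) (RingProperties.-‿distribʳ-* BR.ring (X ^ d) b)))

∼-coef : ∀ {d a b} → a ≐ b → s^- d · a ∼ s^- d · b
∼-coef {d} p = mk∼ (BR.*-congˡ {X ^ d} p)

-- A is s^-d times the series a(s²).
infix 4 _≃s^-_·_
_≃s^-_·_ : Laurent → ℕ → Series → Set
A ≃s^- d · a = A ∼ s^- d · in-s² a

in-s²-series-cong : ∀ {a b} → a ≐ b → in-s² a ≐ in-s² b
in-s²-series-cong p = coefficientwise (in-s²-cong (at p))

in-s²-* : ∀ a b → in-s² a ⊛ in-s² b ≐ in-s² (a ⊛ b)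
in-s²-* a b = coefficientwise λ n → ≡.sym (in-s²-⊛ a b n)

≃-* : ∀ {A B d e a b} → A ≃s^- d · a → B ≃s^- e · b → A L.* B ≃s^- (d ℕ.+ e) · (a ⊛ b)
≃-* {a = a} {b} p q = ∼-trans (∼-* p q) (∼-coef (in-s²-* a b))

≃-1 : L.1# ≃s^- 0 · BR.1#
≃-1 = ∼-coef (BR.trans (coefficientwise λ { zero → ≡.refl ; (suc _) → ≡.refl }) (BR.sym in-s²-1))

≃-^ : ∀ {A d a} → A ≃s^- d · a → ∀ n → A L.^ n ≃s^- (n ℕ.* d) · (a ^ n)
≃-^ p zero    = ≃-1
≃-^ {A} {d} {a} p (suc n) = ≃-* {A} {A L.^ n} {d} {n ℕ.* d} {a} {a ^ n} p (≃-^ p n)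

√x-coef : shift 1 (constant 1ℚ) ≐ X
√x-coef = coefficientwise λ { zero → ≡.refl ; (suc zero) → ≡.refl ; (suc (suc _)) → ≡.refl }

≃-x : x ≃s^- 0 · X
≃-x = ∼-coef (BR.trans (BR.*-cong √x-coef √x-coef) (BR.sym in-s²-X))

≃-1-x : L.1# L.- x ≃s^- 0 · (BR.1# ⊕ ⊝ X)
≃-1-x = ∼-trans (∼-+ ≃-1 (∼-neg ≃-x)) (∼-coef (BR.trans
  (BR.+-congˡ {in-s² BR.1#} (coefficientwise λ n → ≡.sym (in-s²-⊝ X n)))
  (coefficientwise λ n → ≡.sym (in-s²-⊕ BR.1# (⊝ X) n))))

2*1/2√x : (L.1# L.+ L.1#) L.* 1/2√x ∼ s^- 1 · BR.1#
2*1/2√x = ∼-coef (coefficientwise λ where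
  zero    → ≡.refl
  (suc n) → ≡.trans (≡.cong₂ ℚ._+_ (ℚ.*-zeroʳ (1ℚ ℚ.+ 1ℚ))
     (𝔹.⊛-cong {a = λ _ → 0ℚ ℚ.+ 0ℚ} {a′ = λ _ → 0ℚ} {b = constant ½} (λ _ → ≡.refl) (λ _ → ≡.refl) n))
    (≡.trans (ℚ.+-identityˡ _) (𝔹.⊛-zeroˡ (constant ½) n)))

module _ {κ ℓ} (B : CommutativeRing κ ℓ) where
  open CommutativeRing B hiding (zero)
  open NatSolver commutativeSemiring using (solve; _:+_; _:*_; _:=_; con)
  open SetoidReasoning setoid
  open RingProperties ring using (-‿distribˡ-*; -‿distribʳ-*)

  -- Adding Laurent series adds their poles, here `2 + j` and `j`. With v = s^j this removes the
  -- surplus factor s^j.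
  U-step : ∀ s v p r →
    (s * (s * v)) * (v * p + (s * (s * v)) * - r) ≈ ((s * (s * v)) * v) * (p + - (s * s) * r)
  U-step s v p r = begin
    (s * (s * v)) * (v * p + (s * (s * v)) * - r)
      ≈⟨ solve 4 (λ s v p m → (s :* (s :* v)) :* (v :* p :+ (s :* (s :* v)) :* m) :=
           ((s :* (s :* v)) :* v) :* (p :+ (s :* s) :* m)) refl s v p (- r) ⟩
    ((s * (s * v)) * v) * (p + (s * s) * - r)
      ≈⟨ *-congˡ (+-congˡ (trans (sym (-‿distribʳ-* (s * s) r)) (-‿distribˡ-* (s * s) r))) ⟩
    ((s * (s * v)) * v) * (p + - (s * s) * r) ∎

  shuffle : ∀ v g s p → v * (g * (s * p)) ≈ (s * v) * (p * g)
  shuffle = solve 4 (λ v g s p → v :* (g :* (s :* p)) := (s :* v) :* (p :* g)) refl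

-- As 2t = 1/s, the recurrence of `U` reads s^-(j+2) P_{j+1} - s^-j P_j = s^-(j+2) (P_{j+1} - x
-- P_j), with x = s².
≃-U : ∀ j → U j 1/2√x ≃s^- j · CB.P j
≃-U zero          = ≃-1
≃-U (suc zero)    = ∼-trans 2*1/2√x (∼-coef (BR.sym in-s²-1))
≃-U (suc (suc j)) = ∼-trans
  (∼-+ (∼-trans (∼-* 2*1/2√x (≃-U (suc j))) (∼-coef (BR.*-identityˡ p))) (∼-neg (≃-U j)))
  (∼-trans (mk∼
      {s^- (2 ℕ.+ j) ℕ.+ j · (λ n → shift j p n ℚ.+ shift (2 ℕ.+ j) (⊝ r) n)}
      {s^- (2 ℕ.+ j) · (p ⊕ (⊝ (X ⊛ X)) ⊛ r)}
      (BR.trans (BR.*-congˡ {X ^ (2 ℕ.+ j)} (BR.+-cong (shift≐ j p) (shift≐ (2 ℕ.+ j) (⊝ r))))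
      (BR.trans combine (BR.sym (BR.*-congʳ {p ⊕ (⊝ (X ⊛ X)) ⊛ r} (^-homo-* X (2 ℕ.+ j) j))))))
    (∼-coef (BR.sym expand)))
  where
  p = in-s² (CB.P (suc j))
  r = in-s² (CB.P j)
  combine : X ^ (2 ℕ.+ j) ⊛ (X ^ j ⊛ p ⊕ X ^ (2 ℕ.+ j) ⊛ (⊝ r)) ≐
            (X ^ (2 ℕ.+ j) ⊛ X ^ j) ⊛ (p ⊕ (⊝ (X ⊛ X)) ⊛ r)
  combine = U-step 𝔹.commutativeRing X (X ^ j) p r
  expand : in-s² (CB.P (2 ℕ.+ j)) ≐ p ⊕ (⊝ (X ⊛ X)) ⊛ r
  expand = BR.trans (coefficientwise (in-s²-⊕ (CB.P (suc j)) ((⊝ X) ⊛ CB.P j)))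
    (BR.+-congˡ {p} (BR.trans (BR.sym (in-s²-* (⊝ X) (CB.P j)))
      (BR.*-congʳ {r} (BR.trans (coefficientwise (in-s²-⊝ X)) (BR.-‿cong in-s²-X)))))

-- The condition compares exponents of s, where each factor x counts twice.
≃-cancel : ∀ {A B d e m n a} → A ≃s^- d · (X ^ m ⊛ a) → B ≃s^- e · (X ^ n ⊛ a) →
  e ℕ.+ 2 ℕ.* m ≡ d ℕ.+ 2 ℕ.* n → A ∼ B
≃-cancel {d = d} {e} {m} {n} {a} p q eq = ∼-trans p (∼-trans (mk∼
  (BR.trans (collect e m) (BR.trans (BR.reflexive (≡.cong (λ i → X ^ i ⊛ in-s² a) eq))
    (BR.sym (collect d n)))))
  (∼-sym q))
  where
  in-s²-X^ : ∀ m → in-s² (X ^ m) ≐ X ^ (2 ℕ.* m)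
  in-s²-X^ zero    = in-s²-1
  in-s²-X^ (suc m) = BR.trans (BR.sym (in-s²-* X (X ^ m)))
    (BR.trans (BR.*-cong in-s²-X (in-s²-X^ m))
    (BR.trans (BR.*-assoc X X (X ^ (2 ℕ.* m)))
    (BR.reflexive (≡.cong (X ^_) (≡.sym (ℕ.*-suc 2 m))))))
  collect : ∀ e m → X ^ e ⊛ in-s² (X ^ m ⊛ a) ≐ X ^ (e ℕ.+ 2 ℕ.* m) ⊛ in-s² a
  collect e m = BR.trans
    (BR.*-congˡ {X ^ e} (BR.trans (BR.sym (in-s²-* (X ^ m) a)) (BR.*-congʳ {in-s² a} (in-s²-X^ m))))
    (BR.trans (BR.sym (BR.*-assoc (X ^ e) (X ^ (2 ℕ.* m)) (in-s² a)))
      (BR.sym (BR.*-congʳ {in-s² a} (^-homo-* X e (2 ℕ.* m)))))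

nonzero : ∀ {A d a} n → A ∼ s^- d · a → a n ≡ 1ℚ → A L.≉ L.0#
nonzero {A} {d} {a} n p aₙ A≈0 = 1≢0 (≡.trans (≡.sym aₙ) (≡.trans (at a≐0 n) (𝔹.const-0 n)))
  where
  a≐0 : a ≐ BR.0#
  a≐0 = BR.trans (BR.sym (BR.*-identityˡ a))
    (BR.trans (_∼_.cross (∼-trans (∼-sym p) (≈⇒∼ {A} {L.0#} A≈0)))
    (BR.trans (BR.*-congˡ {X ^ d} (coefficientwise λ { zero → ≡.refl ; (suc _) → ≡.refl }))
      (BR.zeroʳ (X ^ d))))

-- From cleared denominators to the stated quotients

module _ (j : ℕ) {g : Series} where

  private
    k = 3 ℕ.+ j
    P = CB.P

  laurent-zero : P k ⊛ g ≐ P (2 ℕ.+ j) → fromSeries g ≈ U (2 ℕ.+ j) 1/2√x ÷ (√x L.* U k 1/2√x)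
  -- The factor √x moves the constant term 1 of `P k` to degree 1.
  laurent-zero eq = nonzero 1 denominator
      (≡.trans (𝔹.X-⊛-suc (in-s² (P k)) 0) (P-constant k)) ,
    ∼⇒≈ (∼-trans (∼-* {fromSeries g} ∼-refl denominator)
      (∼-trans (mk∼ {s^- k · (in-s² g ⊛ (X ⊛ in-s² (P k)))} {s^- (2 ℕ.+ j) · in-s² (P (2 ℕ.+ j))}
        (BR.trans (shuffle 𝔹.commutativeRing (X ^ (2 ℕ.+ j)) (in-s² g) X (in-s² (P k)))
          (BR.*-congˡ {X ^ k} (BR.trans (in-s²-* (P k) g) (in-s²-series-cong eq)))))
      (∼-sym (≃-U (2 ℕ.+ j)))))
    where
    denominator : √x L.* U k 1/2√x ∼ s^- k · (X ⊛ in-s² (P k))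
    denominator = ∼-* {√x} {s^- 0 · X} (∼-coef √x-coef) (≃-U k)

  laurent-suc : ∀ r →
    (BR.1# ⊕ ⊝ X) ^ (1 ℕ.+ r) ⊛ P k ^ (2 ℕ.+ r) ⊛ g ≐ X ^ (2 ℕ.* r ℕ.+ k) ⊛ P (1 ℕ.+ j) ^ r →
    fromSeries g ≈ x L.^ r L.* U (1 ℕ.+ j) 1/2√x L.^ r
      ÷ ((L.1# L.- x) L.^ (1 ℕ.+ r) L.* U k 1/2√x L.^ (2 ℕ.+ r))
  laurent-suc r eq = nonzero 0 denominator
      (⊛-constant {(BR.1# ⊕ ⊝ X) ^ (1 ℕ.+ r)} {P k ^ (2 ℕ.+ r)}
        (^-constant {BR.1# ⊕ ⊝ X} (1 ℕ.+ r) ≡.refl) (^-constant {P k} (2 ℕ.+ r) (P-constant k))) ,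
    ∼⇒≈ (≃-cancel {m = 2 ℕ.* r ℕ.+ k} {n = r} {a = P (1 ℕ.+ j) ^ r}
      (∼-trans (≃-* {fromSeries g} {d = 0} {a = g} ∼-refl denominator)
        (∼-coef (in-s²-series-cong (BR.trans (BR.*-comm g Q) eq))))
      (≃-* (≃-^ ≃-x r) (≃-^ (≃-U (1 ℕ.+ j)) r))
      -- With k = 3 + j the exponents of s agree: r (k - 2) + 2 (2r + k) = (2 + r) k + 2r. The
      -- products with 0 are the poles of the powers of x and 1 - x.
      (solve 2 (λ r j → r :* con 0 :+ r :* (con 1 :+ j) :+ con 2 :* (con 2 :* r :+ (con 3 :+ j)) :=
        (con 1 :+ r) :* con 0 :+ (con 2 :+ r) :* (con 3 :+ j) :+ con 2 :* r) ≡.refl r j))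
    where
    open +-*-Solver using (solve; _:+_; _:*_; _:=_; con)
    Q = (BR.1# ⊕ ⊝ X) ^ (1 ℕ.+ r) ⊛ P k ^ (2 ℕ.+ r)
    denominator : (L.1# L.- x) L.^ (1 ℕ.+ r) L.* U k 1/2√x L.^ (2 ℕ.+ r) ≃s^-
      (1 ℕ.+ r) ℕ.* 0 ℕ.+ (2 ℕ.+ r) ℕ.* k · Q
    denominator = ≃-* (≃-^ ≃-1-x (1 ℕ.+ r)) (≃-^ (≃-U k) (2 ℕ.+ r))

  rational-zero : P k ⊛ g ≐ P (2 ℕ.+ j) → IsRational g
  rational-zero = rational (P (2 ℕ.+ j)) (P k) (polynomial-P (2 ℕ.+ j)) (polynomial-P k) (P-constant k)

  rational-suc : ∀ r →
    (BR.1# ⊕ ⊝ X) ^ (1 ℕ.+ r) ⊛ P k ^ (2 ℕ.+ r) ⊛ g ≐ X ^ (2 ℕ.* r ℕ.+ k) ⊛ P (1 ℕ.+ j) ^ r →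
    IsRational g
  rational-suc r = rational
    (X ^ (2 ℕ.* r ℕ.+ k) ⊛ P (1 ℕ.+ j) ^ r) ((BR.1# ⊕ ⊝ X) ^ (1 ℕ.+ r) ⊛ P k ^ (2 ℕ.+ r))
    (polynomial-⊛ {X ^ (2 ℕ.* r ℕ.+ k)} {P (1 ℕ.+ j) ^ r}
      (polynomial-^ {X} polynomial-X (2 ℕ.* r ℕ.+ k))
      (polynomial-^ {P (1 ℕ.+ j)} (polynomial-P (1 ℕ.+ j)) r))
    (polynomial-⊛ {(BR.1# ⊕ ⊝ X) ^ (1 ℕ.+ r)} {P k ^ (2 ℕ.+ r)}
      (polynomial-^ {BR.1# ⊕ ⊝ X}
        (polynomial-⊕ {BR.1#} {⊝ X} polynomial-1 (polynomial-⊝ {X} polynomial-X)) (1 ℕ.+ r))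
      (polynomial-^ {P k} (polynomial-P k) (2 ℕ.+ r)))
    (⊛-constant {(BR.1# ⊕ ⊝ X) ^ (1 ℕ.+ r)} {P k ^ (2 ℕ.+ r)}
        (^-constant {BR.1# ⊕ ⊝ X} (1 ℕ.+ r) ≡.refl) (^-constant {P k} (2 ℕ.+ r) (P-constant k)))

theorem2p8 : (k : ℕ) → 3 ≤ k →
    (∀ r → r ≤ k ∸ 2 → IsRational (F (12-3-⋯-k k) r)) ×
    (∀ r → 1 ≤ r → r ≤ k ∸ 2 →
    fromSeries (F (12-3-⋯-k k) r) ≈
    x L.^ (r ∸ 1) L.* U (k ∸ 2) 1/2√x L.^ (r ∸ 1)
    ÷ ((L.1# L.- x) L.^ r L.* U k 1/2√x L.^ suc r)) ×
    (fromSeries (F (12-3-⋯-k k) 0) ≈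
    U (k ∸ 1) 1/2√x ÷ (√x L.* U k 1/2√x))
theorem2p8 (suc (suc (suc j))) (s≤s (s≤s (s≤s z≤n))) =
  (λ where
    zero    _         → rational-zero j (closed-zero j (F≐q-coef j 0 z≤n))
    (suc r) (s≤s r≤j) → rational-suc j r (closed-suc j r (F≐q-coef j (suc r) (s≤s r≤j)))) ,
  (λ where
    (suc r) _ (s≤s r≤j) → laurent-suc j r (closed-suc j r (F≐q-coef j (suc r) (s≤s r≤j)))) ,
  laurent-zero j (closed-zero j (F≐q-coef j 0 z≤n))
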